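{- $gr^3_2(B_{15})=25$.
   Context: $K_n$ is the complete graph of order $n$. The book $B_n:=K_2+nK_1$ (graph join) is the graph on $n+2$ vertices consisting of an edge $xy$ (the spine) together with $n$ further, pairwise non-adjacent vertices (the pages), each adjacent to both $x$ and $y$. A $t$-coloring of $K_p$ is a map $f:E(K_p)\to\{1,\dots,t\}$, not assumed surjective. A Gallai $t$-coloring is a $t$-coloring with no rainbow triangle, i.e. there are no three vertices $x,y,z$ such that $f(xy),f(xz),f(yz)$ are pairwise distinct. For $1\le s<t$ and a graph $G$, the weakened Gallai-Ramsey number $gr^t_s(G)$ is the least $p\in\mathbb{N}$ such that every Gallai $t$-coloring of $K_p$ contains a (not necessarily induced) subgraph isomorphic to $G$ whose edges use at most $s$ colors. -}

module Defs where

open import Data.Empty using (⊥)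
open import Data.Fin.Base using (Fin)
open import Data.Fin.Subset using (Subset; _∈_; ∣_∣)
open import Data.Nat.Base using (ℕ; _≤_)
open import Data.Product.Base using (_×_; Σ-syntax; ∃-syntax)
open import Data.Sum.Base using (_⊎_; inj₁; inj₂)
open import Data.Unit.Base using (⊤; tt)
open import Function.Definitions using (Injective)
open import Relation.Binary.Definitions using (Symmetric; Irreflexive)
open import Relation.Binary.PropositionalEquality.Core using (_≡_; _≢_; ≢-sym)
open import Relation.Nullary.Negation.Core using (¬_)

record Graph : Set₁ where
  field
    Vertex : Set
    Adj    : Vertex → Vertex → Set
    sym    : Symmetric Adj
    irrefl : Irreflexive _≡_ Adj

open Graph public using (Vertex; Adj)

K : ℕ → Graph
K p = record
  { Vertex = Fin p
  ; Adj    = _≢_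
  ; sym    = ≢-sym
  ; irrefl = λ x≡y x≢y → x≢y x≡y
  }

-- The disjoint union of n copies of K₁.
_K₁ : ℕ → Graph
n K₁ = record
  { Vertex = Fin n
  ; Adj    = λ _ _ → ⊥
  ; sym    = λ ()
  ; irrefl = λ _ ()
  }

-- The graph join, written G + H in the literature.
_∨_ : Graph → Graph → Graph
G ∨ H = record
  { Vertex = Vertex G ⊎ Vertex H
  ; Adj    = adj
  ; sym    = λ {u} {v} → adj-sym u v
  ; irrefl = λ {u} {v} → adj-irrefl u v
  }
  where
  adj : Vertex G ⊎ Vertex H → Vertex G ⊎ Vertex H → Set
  adj (inj₁ u) (inj₁ v) = Adj G u v
  adj (inj₁ _) (inj₂ _) = ⊤
  adj (inj₂ _) (inj₁ _) = ⊤
  adj (inj₂ u) (inj₂ v) = Adj H u v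

  adj-sym : ∀ u v → adj u v → adj v u
  adj-sym (inj₁ _) (inj₁ _) e = Graph.sym G e
  adj-sym (inj₁ _) (inj₂ _) _ = tt
  adj-sym (inj₂ _) (inj₁ _) _ = tt
  adj-sym (inj₂ _) (inj₂ _) e = Graph.sym H e

  adj-irrefl : ∀ u v → u ≡ v → ¬ adj u v
  adj-irrefl (inj₁ _) (inj₁ _) _≡_.refl e = Graph.irrefl G _≡_.refl e
  adj-irrefl (inj₂ _) (inj₂ _) _≡_.refl e = Graph.irrefl H _≡_.refl e

Book : ℕ → Graph
Book n = K 2 ∨ (n K₁)

-- `undirected` relates arbitrary proofs of adjacency in the two directions, so
-- it also makes the colour independent of the adjacency proof.  A colouring is
-- thus exactly a map from the set of unordered edges to the colours.
record Coloring (t : ℕ) (G : Graph) : Set where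
  field
    colour     : ∀ {u v} → Adj G u v → Fin t
    undirected : ∀ {u v} (e : Adj G u v) (e′ : Adj G v u) → colour e ≡ colour e′

open Coloring public using (colour)

RainbowTriangle : ∀ {t G} → Coloring t G → Set
RainbowTriangle {G = G} f =
  ∃[ x ] ∃[ y ] ∃[ z ]
  Σ[ xy ∈ Adj G x y ] Σ[ xz ∈ Adj G x z ] Σ[ yz ∈ Adj G y z ]
    colour f xy ≢ colour f xz × colour f xy ≢ colour f yz × colour f xz ≢ colour f yz

Gallai : ∀ {t G} → Coloring t G → Set
Gallai f = ¬ RainbowTriangle f

-- A subgraph of H isomorphic to G, not necessarily induced, given by the
-- isomorphism onto it.
record Copy (G H : Graph) : Set where
  field
    vertex    : Vertex G → Vertex H
    injective : Injective _≡_ _≡_ vertex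
    edge      : ∀ {u v} → Adj G u v → Adj H (vertex u) (vertex v)

UsesAtMost : ∀ {t G H} → ℕ → Coloring t H → Copy G H → Set
UsesAtMost {t} {G} s f c =
  Σ[ S ∈ Subset t ] ∣ S ∣ ≤ s × (∀ {u v} (e : Adj G u v) → colour f (Copy.edge c e) ∈ S)

EveryGallaiColoringContains : (t s : ℕ) → Graph → ℕ → Set
EveryGallaiColoringContains t s G p =
  (f : Coloring t (K p)) → Gallai f → Σ[ c ∈ Copy G (K p) ] UsesAtMost s f c

IsLeast : (ℕ → Set) → ℕ → Set
IsLeast P p = P p × (∀ q → P q → p ≤ q)

-- gr[ t , s ] G ≔ p states that the weakened Gallai-Ramsey number gr^t_s(G),
-- for 1 ≤ s < t, exists and equals p.
gr[_,_]_≔_ : (t s : ℕ) → Graph → ℕ → Set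
gr[ t , s ] G ≔ p = IsLeast (EveryGallaiColoringContains t s G) p

{-# OPTIONS --safe #-}

-- Lower bound: join two copies of the Paley graph of order 13, each less a
-- vertex, completely in the third colour.
--
-- Upper bound: suppose that K₂₅ has a Gallai 3-colouring without a two-coloured
-- B₁₅.  Then for each edge xy and each colour e other than that of xy at least
-- nine vertices are joined to x or y in e; for the two possible e these sets
-- are disjoint, so xy has at most five monochromatic pages.  Some colour, say
-- red, is disconnected, and any two of its components are joined in a single
-- colour, green or blue.  If V is the join in one colour of two sides of at
-- least two vertices, then neither side contains an edge of that colour, both
-- have at least 11 vertices, and the smaller one, of at most 12, has an edge
-- with too many monochromatic pages.  A vertex joined to all others in one
-- colour is set aside; what remains is not a join.  Then the green and the blue
-- graph on the red components are both connected, while the degree bounds allow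
-- at most four components, so both graphs are paths P₄.  Counting pages on red
-- edges in its two inner components bounds the total size of the end components
-- of such a path by 10; hence the four components have at most 20 vertices,
-- although at least 24 remain.

module Submission where

open import Defs

open import Data.Bool.Base using (Bool; true; false; not; _∧_; T) renaming (_∨_ to _or_)
open import Data.Bool.Properties using (not-injective) renaming (_≟_ to _≟ᵇ_)
open import Data.Empty using (⊥; ⊥-elim)
open import Data.Fin.Base using (Fin; zero; suc; toℕ; inject≤)
open import Data.Fin.Properties using (_≟_; any?; suc-injective; inject≤-injective; toℕ-inject≤)
open import Data.Fin.Subset using (Subset; ∣_∣; ∁; ⁅_⁆; _∈_; inside; outside)
open import Data.Fin.Subset.Properties using (∣∁p∣≡n∸∣p∣; ∣⁅x⁆∣≡1; x∉p⇒x∈∁p; x∈⁅y⁆⇒x≡y)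
open import Data.List.Base using (List; []; _∷_; map; length; filter; allFin; tabulate; cartesianProduct)
open import Data.List.Membership.DecPropositional using (_∈?_)
open import Data.List.Membership.Propositional using () renaming (_∈_ to _∈ˡ_)
open import Data.List.Membership.Propositional.Properties
  using (∈-filter⁺; ∈-filter⁻; ∈-cartesianProduct⁺; ∈-allFin)
open import Data.List.Properties using (length-tabulate; map-∘)
open import Data.List.Relation.Unary.All using (All; []; _∷_)
open import Data.List.Relation.Unary.AllPairs using ([]; _∷_)
open import Data.List.Relation.Unary.Any using (here; there)
open import Data.List.Relation.Unary.Unique.Propositional using (Unique)
open import Data.List.Relation.Unary.Unique.Propositional.Properties using (tabulate⁺)
open import Data.Nat.Base using (ℕ; zero; suc; _+_; _≤_; _≤ᵇ_; _<ᵇ_; _∸_; ∣_-_∣; z≤n; s≤s)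
open import Data.Nat.ListAction using (sum)
open import Data.Nat.Properties
  using (≤ᵇ⇒≤; ≤-refl; ≤-trans; ≤-reflexive; ≤-antisym; ≤-total; ≤-pred; ≰⇒>; ≮⇒≥; _≤?_; 1+n≰n;
         m≤m+n; m≤n+m; +-comm; +-identityʳ; +-mono-≤; +-monoʳ-≤; +-cancelˡ-≤; +-cancelʳ-≤; ∣-∣-comm)
open import Data.Nat.Tactic.RingSolver using (solve-∀)
open import Data.Product.Base using (Σ-syntax; ∃-syntax; _×_; _,_; proj₁; proj₂)
open import Data.Sum.Base using (_⊎_; inj₁; inj₂)
open import Data.Sum.Properties using (inj₂-injective)
open import Data.Unit.Base using (tt)
open import Data.Vec.Base using ([]; _∷_; here; there)
open import Function.Base using (_∘_; case_of_)
open import Function.Definitions using (Injective)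
open import Level using (0ℓ)
open import Relation.Binary.Core using (Rel)
open import Relation.Binary.Definitions using (Decidable)
open import Relation.Binary.PropositionalEquality
  using (_≡_; _≢_; refl; sym; trans; cong; cong₂; subst; subst₂)
open import Relation.Binary.Structures using (IsEquivalence)
open import Relation.Nullary.Decidable using (Dec; yes; no; decidable-stable; ⌊_⌋; _×-dec_; ¬?)
open import Relation.Nullary.Negation.Core using (¬_; contradiction)

-- Counting

⟦_⟧ : Bool → ℕ
⟦ true ⟧  = 1
⟦ false ⟧ = 0

#_ : ∀ {n} → (Fin n → Bool) → ℕ
#_ {zero}  p = 0
#_ {suc n} p = ⟦ p zero ⟧ + # (p ∘ suc)

weights : ∀ {n} → List (Fin n → Bool) → Fin n → List ℕ
weights ps z = map (λ p → ⟦ p z ⟧) ps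

weigh₀ : ∀ {n} (ps : List (Fin (suc n) → Bool)) →
         sum (map #_ ps) ≡ sum (weights ps zero) + sum (map #_ (map (_∘ suc) ps))
weigh₀ []       = refl
weigh₀ (p ∷ ps) rewrite weigh₀ ps = rearrange ⟦ p zero ⟧ _ (sum (weights ps zero)) _
  where
  rearrange : ∀ a b c d → (a + b) + (c + d) ≡ (a + c) + (b + d)
  rearrange = solve-∀

weights-suc : ∀ {n} (ps : List (Fin (suc n) → Bool)) z →
              weights (map (_∘ suc) ps) z ≡ weights ps (suc z)
weights-suc []       z = refl
weights-suc (p ∷ ps) z = cong (_ ∷_) (weights-suc ps z)

-- Double counting. All size estimates below come from this: the two lists are families of sets,
-- with repetition for multiplicity, and only the weights at a single vertex z have to be compared.
weigh : ∀ {n} (ps qs : List (Fin n → Bool)) →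
        (∀ z → sum (weights ps z) ≤ sum (weights qs z)) →
        sum (map #_ ps) ≤ sum (map #_ qs)
weigh {zero}  ps qs _ = ≤-trans (≤-reflexive (void ps)) z≤n
  where
  void : (rs : List (Fin 0 → Bool)) → sum (map #_ rs) ≡ 0
  void []       = refl
  void (_ ∷ rs) = void rs
weigh {suc n} ps qs le rewrite weigh₀ ps | weigh₀ qs =
  +-mono-≤ (le zero) (weigh (map (_∘ suc) ps) (map (_∘ suc) qs) λ z →
    subst₂ (λ as bs → sum as ≤ sum bs) (sym (weights-suc ps z)) (sym (weights-suc qs z)) (le (suc z)))

#-cong : ∀ {n} {p q : Fin n → Bool} → (∀ z → p z ≡ q z) → # p ≡ # q
#-cong {zero}  eq = refl
#-cong {suc n} eq = cong₂ (λ b → ⟦ b ⟧ +_) (eq zero) (#-cong (eq ∘ suc))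

everything : ∀ {n} → Fin n → Bool
everything _ = true

#-everything : ∀ n → # (everything {n}) ≡ n
#-everything zero    = refl
#-everything (suc n) = cong suc (#-everything n)

#-none : ∀ n → # (λ (_ : Fin n) → false) ≡ 0
#-none zero    = refl
#-none (suc n) = #-none n

_==_ : ∀ {n} → Fin n → Fin n → Bool
x == y = ⌊ x ≟ y ⌋

==-refl : ∀ {n} (x : Fin n) → (x == x) ≡ true
==-refl x with x ≟ x
... | yes _  = refl
... | no x≢x = contradiction refl x≢x

==⇒≡ : ∀ {n} {x y : Fin n} → (x == y) ≡ true → x ≡ y
==⇒≡ {x = x} {y} e with x ≟ y
... | yes x≡y = x≡y

≢⇒== : ∀ {n} {x y : Fin n} → x ≢ y → (x == y) ≡ false
≢⇒== {x = x} {y} x≢y with x ≟ y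
... | yes x≡y = contradiction x≡y x≢y
... | no _    = refl

==⇒≢ : ∀ {n} {x y : Fin n} → (x == y) ≡ false → x ≢ y
==⇒≢ {x = x} e refl = case trans (sym (==-refl x)) e of λ ()

#-single : ∀ {n} (x : Fin n) → # (x ==_) ≡ 1
#-single {suc n} zero    = cong suc (#-none n)
#-single {suc n} (suc x) = trans (#-cong suc-==) (#-single x)
  where
  suc-== : ∀ z → (suc x == suc z) ≡ (x == z)
  suc-== z with x ≟ z
  ... | yes _ = refl
  ... | no  _ = refl

#-single≥1 : ∀ {n} (x : Fin n) → 1 ≤ # (x ==_)
#-single≥1 x = ≤-reflexive (sym (#-single x))

infixr 7 _⊕_

_⊕_ : ∀ {a b c d} → a ≤ b → c ≤ d → a + c ≤ b + d
_⊕_ = +-mono-≤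

embed : ∀ {n} k (p : Fin n → Bool) → k ≤ # p →
        Σ[ φ ∈ (Fin k → Fin n) ] Injective _≡_ _≡_ φ × (∀ i → p (φ i) ≡ true)
embed zero p _ = (λ ()) , (λ { {()} }) , λ ()
embed {suc n} (suc k) p le with p zero in p0 | le
... | false | le′ with φ , inj , pφ ← embed (suc k) (p ∘ suc) le′ =
  suc ∘ φ , inj ∘ suc-injective , pφ
... | true | s≤s le′ with φ , inj , pφ ← embed k (p ∘ suc) le′ =
  (λ { zero → zero ; (suc i) → suc (φ i) }) ,
  (λ { {zero} {zero} _ → refl ; {suc _} {suc _} e → cong suc (inj (suc-injective e)) }) ,
  (λ { zero → p0 ; (suc i) → pφ i })

pick : ∀ {n} {p : Fin n → Bool} → 1 ≤ # p → ∃[ z ] p z ≡ true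
pick {p = p} le with φ , _ , pφ ← embed 1 p le = φ zero , pφ zero

sum-unique : ∀ {n} {xs : List (Fin n)} → Unique xs → ∀ z → sum (map (λ x → ⟦ x == z ⟧) xs) ≤ 1
sum-unique []                 z = z≤n
sum-unique {xs = x ∷ xs} (x∉ ∷ uniq) z with x ≟ z
... | no _     = sum-unique uniq z
... | yes refl = s≤s (≤-reflexive (vanish x∉))
  where
  vanish : ∀ {ys} → All (x ≢_) ys → sum (map (λ y → ⟦ y == x ⟧) ys) ≡ 0
  vanish []            = refl
  vanish (x≢y ∷ rest) rewrite ≢⇒== (λ y≡x → x≢y (sym y≡x)) = vanish rest

-- The singletons of the k values all lie in p, and by injectivity no vertex is in two of them, so
-- `weigh` bounds their total size.
injection⇒# : ∀ {n k} {p : Fin n → Bool} {φ : Fin k → Fin n} →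
              Injective _≡_ _≡_ φ → (∀ i → p (φ i) ≡ true) → k ≤ # p
injection⇒# {n} {k} {p} {φ} inj pφ =
  subst₂ _≤_ (trans (total xs) (length-tabulate φ)) (+-identityʳ _)
    (weigh (map _==_ xs) (p ∷ []) pointwise)
  where
  xs = tabulate φ
  total : ∀ ys → sum (map #_ (map _==_ ys)) ≡ length ys
  total []       = refl
  total (y ∷ ys) = cong₂ _+_ (#-single y) (total ys)
  members : ∀ {m} (ψ : Fin m → Fin n) z → (∀ i → ψ i ≢ z) →
            sum (weights (map _==_ (tabulate ψ)) z) ≡ 0
  members {zero}  ψ z ∉ = refl
  members {suc m} ψ z ∉ rewrite ≢⇒== (∉ zero) = members (ψ ∘ suc) z (∉ ∘ suc)
  pointwise : ∀ z → sum (weights (map _==_ xs) z) ≤ ⟦ p z ⟧ + 0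
  pointwise z with any? (λ i → φ i ≟ z)
  ... | yes (i , refl) rewrite pφ i =
    subst (λ ns → sum ns ≤ 1) (map-∘ xs) (sum-unique (tabulate⁺ inj) (φ i))
  ... | no ∄ = ≤-trans (≤-reflexive (members φ z λ i e → ∄ (i , e))) z≤n

-- Numerical contradictions are reached by adding inequalities with `⊕` and ending here; k is the
-- amount by which the sum fails beyond one.
impossible : ∀ {m n} → m ≤ n → ∀ k → m ≡ suc (n + k) → ⊥
impossible {n = n} le k refl = 1+n≰n (≤-trans (s≤s (m≤m+n n k)) le)
-- Gallai 3-colourings without large two-coloured books

-- The Boolean indices make a match on `One` evaluate the sums in the case tables below; d tells
-- whether the two vertices coincide.
data One : (d r g b : Bool) → Set where
  diag  : One true false false false
  red   : One false true false false
  green : One false false true false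
  blue  : One false false false true

Relation : ℕ → Set
Relation n = Fin n → Fin n → Bool

-- The three colour classes of a Gallai colouring.  If fewer than nine vertices
-- are joined to x or y in a colour other than that of xy, then at least 15 of
-- the 23 further vertices are pages at xy avoiding that colour.
record Triple {n} (R G B : Relation n) : Set where
  field
    one    : ∀ x y → One (x == y) (R x y) (G x y) (B x y)
    symR   : ∀ x y → R x y ≡ R y x
    symG   : ∀ x y → G x y ≡ G y x
    symB   : ∀ x y → B x y ≡ B y x
    gallai : ∀ x y z → R x y ≡ true → G x z ≡ true → B y z ≡ true → ⊥
    manyR  : ∀ x y → (x == y) ≡ false → R x y ≡ false → 9 ≤ # (λ z → R x z or R y z)
    manyG  : ∀ x y → (x == y) ≡ false → G x y ≡ false → 9 ≤ # (λ z → G x z or G y z)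
    manyB  : ∀ x y → (x == y) ≡ false → B x y ≡ false → 9 ≤ # (λ z → B x z or B y z)

-- Together with `swap` this generates all permutations of the colours, so each lemma is proved for
-- one choice of colours only.
rotate : ∀ {n} {R G B : Relation n} → Triple R G B → Triple G B R
rotate t = record
  { one    = λ x y → turn (one x y)
  ; symR   = symG ; symG = symB ; symB = symR
  ; gallai = λ x y z gxy bxz ryz → gallai y z x ryz (trans (symG y x) gxy) (trans (symB z x) bxz)
  ; manyR  = manyG ; manyG = manyB ; manyB = manyR
  }
  where
  open Triple t
  turn : ∀ {d r g b} → One d r g b → One d g b r
  turn diag  = diag
  turn red   = blue
  turn green = red
  turn blue  = green

swap : ∀ {n} {R G B : Relation n} → Triple R G B → Triple R B G
swap t = record
  { one    = λ x y → flip (one x y)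
  ; symR   = symR ; symG = symB ; symB = symG
  ; gallai = λ x y z rxy bxz gyz → gallai y x z (trans (symR y x) rxy) gyz bxz
  ; manyR  = manyR ; manyG = manyB ; manyB = manyG
  }
  where
  open Triple t
  flip : ∀ {d r g b} → One d r g b → One d r b g
  flip diag  = diag
  flip red   = red
  flip green = blue
  flip blue  = green

by≤ : ∀ {m n} {_ : T (m ≤ᵇ n)} → m ≤ n
by≤ {m} {n} {t} = ≤ᵇ⇒≤ m n t

-- The two `One` data belong to xz and yz for a red edge xy. The first two hypotheses cover z at an
-- end of the edge, the last two are the Gallai condition on the triangle xyz.
spine-red : ∀ {d r g b d′ r′ g′ b′} → One d r g b → One d′ r′ g′ b′ →
            (d ≡ true → r′ ≡ true) → (d′ ≡ true → r ≡ true) →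
            (g ≡ true → b′ ≡ true → ⊥) → (b ≡ true → g′ ≡ true → ⊥) →
            ⟦ r ∧ r′ ⟧ + (⟦ g or g′ ⟧ + (⟦ b or b′ ⟧ + (⟦ d ⟧ + (⟦ d′ ⟧ + 0)))) ≤ 1
spine-red diag  diag  p _ _ _ = case p refl of λ ()
spine-red diag  red   _ _ _ _ = by≤
spine-red diag  green p _ _ _ = case p refl of λ ()
spine-red diag  blue  p _ _ _ = case p refl of λ ()
spine-red red   diag  _ _ _ _ = by≤
spine-red red   red   _ _ _ _ = by≤
spine-red red   green _ _ _ _ = by≤
spine-red red   blue  _ _ _ _ = by≤
spine-red green diag  _ p _ _ = case p refl of λ ()
spine-red green red   _ _ _ _ = by≤
spine-red green green _ _ _ _ = by≤
spine-red green blue  _ _ p _ = ⊥-elim (p refl refl)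
spine-red blue  diag  _ p _ _ = case p refl of λ ()
spine-red blue  red   _ _ _ _ = by≤
spine-red blue  green _ _ _ p = ⊥-elim (p refl refl)
spine-red blue  blue  _ _ _ _ = by≤

spine-green : ∀ {d r g b d′ r′ g′ b′} → One d r g b → One d′ r′ g′ b′ →
              (d ≡ true → g′ ≡ true) → (d′ ≡ true → g ≡ true) →
              ⟦ b or b′ ⟧ + (⟦ d ⟧ + (⟦ d′ ⟧ + 0)) ≤ 1
spine-green diag  diag  p _ = case p refl of λ ()
spine-green diag  red   p _ = case p refl of λ ()
spine-green diag  green _ _ = by≤
spine-green diag  blue  p _ = case p refl of λ ()
spine-green red   diag  _ p = case p refl of λ ()
spine-green red   red   _ _ = by≤
spine-green red   green _ _ = by≤
spine-green red   blue  _ _ = by≤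
spine-green green diag  _ _ = by≤
spine-green green red   _ _ = by≤
spine-green green green _ _ = by≤
spine-green green blue  _ _ = by≤
spine-green blue  diag  _ p = case p refl of λ ()
spine-green blue  red   _ _ = by≤
spine-green blue  green _ _ = by≤
spine-green blue  blue  _ _ = by≤

at : ∀ {n} {C : Relation n} {x y z} → C y x ≡ true → (x == z) ≡ true → C y z ≡ true
at {C = C} {y = y} e x=z = subst (λ w → C y w ≡ true) (==⇒≡ x=z) e

module _ {n} {R G B : Relation n} (t : Triple R G B) where
  open Triple t

  edge≢ : ∀ {x y} → R x y ≡ true → (x == y) ≡ false
  edge≢ {x} {y} = go (one x y)
    where
    go : ∀ {d r g b} → One d r g b → r ≡ true → d ≡ false
    go red _ = refl

  R⇒¬G : ∀ {x y} → R x y ≡ true → G x y ≡ false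
  R⇒¬G {x} {y} = go (one x y)
    where
    go : ∀ {d r g b} → One d r g b → r ≡ true → g ≡ false
    go red _ = refl

  ≢⇒RGB : ∀ {x y} → (x == y) ≡ false → R x y ≡ true ⊎ G x y ≡ true ⊎ B x y ≡ true
  ≢⇒RGB {x} {y} = go (one x y)
    where
    go : ∀ {d r g b} → One d r g b → d ≡ false → r ≡ true ⊎ g ≡ true ⊎ b ≡ true
    go red   _ = inj₁ refl
    go green _ = inj₂ (inj₁ refl)
    go blue  _ = inj₂ (inj₂ refl)

  spine-sets : Fin n → Fin n → List (Fin n → Bool)
  spine-sets x y = (λ z → R x z ∧ R y z) ∷ (λ z → G x z or G y z) ∷ (λ z → B x z or B y z) ∷
                   (x ==_) ∷ (y ==_) ∷ []

  -- The five sets are disjoint: no vertex sees one end of a red edge in green and the other in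
  -- blue.
  spine : ∀ {x y} → R x y ≡ true → ∀ z → sum (weights (spine-sets x y) z) ≤ 1
  spine {x} {y} rxy z = spine-red (one x z) (one y z)
    (at {C = R} ryx) (at {C = R} rxy)
    (λ gxz byz → gallai x y z rxy gxz byz) (λ bxz gyz → gallai y x z ryx gyz bxz)
    where ryx = trans (symR y x) rxy

-- The order stays a variable tied to 25 by an equation; over a literal 25 each `#` could unfold
-- into a sum of 25 terms.
module Order25 {n} (n≡25 : n ≡ 25) where

  total : # (everything {n}) + 0 ≡ 25
  total = trans (+-identityʳ _) (trans (#-everything n) n≡25)

  complement : (S : Fin n → Bool) → # S + # (not ∘ S) ≡ 25
  complement S = trans (sym (cong (# S +_) (+-identityʳ _)))
    (trans (≤-antisym (weigh (S ∷ (not ∘ S) ∷ []) (everything ∷ []) λ z → ≤-reflexive (b+¬b (S z)))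
                      (weigh (everything ∷ []) (S ∷ (not ∘ S) ∷ []) λ z → ≤-reflexive (sym (b+¬b (S z)))))
           total)
    where
    b+¬b : ∀ b → ⟦ b ⟧ + (⟦ not b ⟧ + 0) ≡ 1
    b+¬b true  = refl
    b+¬b false = refl

  monochromatic-pages : ∀ {R G B : Relation n} → Triple R G B → ∀ {x y} → R x y ≡ true →
                        # (λ z → R x z ∧ R y z) ≤ 5
  -- Of the 25 vertices, 20 are taken by nine seen in green, nine seen in blue and the two ends.
  monochromatic-pages {R} {G} {B} t {x} {y} rxy = +-cancelʳ-≤ 20 _ 5
    (≤-trans (+-monoʳ-≤ (# (λ z → R x z ∧ R y z))
               (manyG x y (edge≢ t rxy) (R⇒¬G t rxy) ⊕
                manyB x y (edge≢ t rxy) (R⇒¬G (swap t) rxy) ⊕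
                #-single≥1 x ⊕ #-single≥1 y ⊕ z≤n))
      (≤-trans (weigh (spine-sets t x y) (everything ∷ []) (spine t rxy)) (≤-reflexive total)))
    where open Triple t

-- The sides of a red join

both-red : ∀ {d r g b d′ r′ g′ b′} → One d r g b → One d′ r′ g′ b′ → r ≡ true → r′ ≡ true →
           ⟦ b or b′ ⟧ + (⟦ d ⟧ + (⟦ d′ ⟧ + 0)) ≤ 0
both-red red red _ _ = by≤

both-red′ : ∀ {d r g b d′ r′ g′ b′} → One d r g b → One d′ r′ g′ b′ → r ≡ true → r′ ≡ true →
            ⟦ g or g′ ⟧ + (⟦ b or b′ ⟧ + (⟦ d ⟧ + (⟦ d′ ⟧ + 0))) ≤ 0
both-red′ red red _ _ = by≤

-- u, w and z are vertices of one side of a red join, seen from v, where uv is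
-- green and uw is blue.
green-blue-path :
  ∀ {d r g b dᵘ rᵘ gᵘ bᵘ dʷ rʷ gʷ bʷ} →
  One d r g b → One dᵘ rᵘ gᵘ bᵘ → One dʷ rʷ gʷ bʷ →
  r ≡ rᵘ → r ≡ rʷ → (d ≡ true → gᵘ ≡ true) → (d ≡ true → gʷ ≡ true) →
  (dᵘ ≡ true → g ≡ true) → (dᵘ ≡ true → bʷ ≡ true) →
  (dʷ ≡ true → g ≡ true) → (dʷ ≡ true → bᵘ ≡ true) →
  ⟦ bᵘ or b ⟧ + (⟦ bʷ or b ⟧ + (⟦ gᵘ or gʷ ⟧ + (⟦ dᵘ ⟧ + (⟦ dʷ ⟧ + (⟦ g ⟧ + 0))))) ≤
  ⟦ b ⟧ + (⟦ b ⟧ + (⟦ b ⟧ + (⟦ g ⟧ + (⟦ g ⟧ + (⟦ g ⟧ + (⟦ d ⟧ + 0))))))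
green-blue-path diag  diag  _     _ _ p _ _ _ _ _ = case p refl of λ ()
green-blue-path diag  red   _     () _ _ _ _ _ _ _
green-blue-path diag  blue  _     _ _ p _ _ _ _ _ = case p refl of λ ()
green-blue-path diag  green diag  _ _ _ p _ _ _ _ = case p refl of λ ()
green-blue-path diag  green red   _ () _ _ _ _ _ _
green-blue-path diag  green green _ _ _ _ _ _ _ _ = by≤
green-blue-path diag  green blue  _ _ _ p _ _ _ _ = case p refl of λ ()
green-blue-path red   red   red   _ _ _ _ _ _ _ _ = by≤
green-blue-path green diag  diag  _ _ _ _ _ p _ _ = case p refl of λ ()
green-blue-path green diag  red   _ () _ _ _ _ _ _
green-blue-path green diag  green _ _ _ _ _ p _ _ = case p refl of λ ()
green-blue-path green diag  blue  _ _ _ _ _ _ _ _ = by≤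
green-blue-path green red   _     () _ _ _ _ _ _ _
green-blue-path green green diag  _ _ _ _ _ _ _ p = case p refl of λ ()
green-blue-path green green red   _ () _ _ _ _ _ _
green-blue-path green green green _ _ _ _ _ _ _ _ = by≤
green-blue-path green green blue  _ _ _ _ _ _ _ _ = by≤
green-blue-path green blue  diag  _ _ _ _ _ _ _ _ = by≤
green-blue-path green blue  red   _ () _ _ _ _ _ _
green-blue-path green blue  green _ _ _ _ _ _ _ _ = by≤
green-blue-path green blue  blue  _ _ _ _ _ _ _ _ = by≤
green-blue-path blue  diag  _     _ _ _ _ p _ _ _ = case p refl of λ ()
green-blue-path blue  red   _     () _ _ _ _ _ _ _
green-blue-path blue  green diag  _ _ _ _ _ _ p _ = case p refl of λ ()
green-blue-path blue  green red   _ () _ _ _ _ _ _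
green-blue-path blue  green green _ _ _ _ _ _ _ _ = by≤
green-blue-path blue  green blue  _ _ _ _ _ _ _ _ = by≤
green-blue-path blue  blue  diag  _ _ _ _ _ _ p _ = case p refl of λ ()
green-blue-path blue  blue  red   _ () _ _ _ _ _ _
green-blue-path blue  blue  green _ _ _ _ _ _ _ _ = by≤
green-blue-path blue  blue  blue  _ _ _ _ _ _ _ _ = by≤

-- Here g and b are the green and blue degrees of a vertex in a side without red edges. They add up
-- to at most 11, so the smaller is at most five.
degree-bounds : ∀ {g b} → b ≤ g → 11 ≤ g + (b + 1) → g + (b + 1) ≤ 12 → 1 ≤ g × b ≤ 5
degree-bounds {g} {b} b≤g 11≤ ≤12 = positive g b≤g 11≤ , ≮⇒≥ λ 6≤b →
  impossible (6≤b ⊕ ≤-trans 6≤b b≤g ⊕ ≤12) 0 (arith b g)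
  where
  positive : ∀ g → b ≤ g → 11 ≤ g + (b + 1) → 1 ≤ g
  positive zero    z≤n le = case le of λ { (s≤s ()) }
  positive (suc g) _   _  = s≤s z≤n
  arith : ∀ b g → 6 + (6 + (g + (b + 1))) ≡ suc (b + (g + 12) + 0)
  arith = solve-∀

-- S is one side of a red join.
record Side {n} (R G B : Relation n) (S : Fin n → Bool) : Set where
  field
    triple : Triple R G B
    out    : ∀ {x z} → S x ≡ true → S z ≡ false → R x z ≡ true

swap-side : ∀ {n} {R G B : Relation n} {S} → Side R G B S → Side R B G S
swap-side s = record { triple = swap triple ; out = out }
  where open Side s

module _ {n} {R G B : Relation n} {S : Fin n → Bool} (s : Side R G B S) where
  open Side s
  open Triple triple

  -- Vertices outside S see x and y in red, so the nine vertices seen in blue from x or y lie in S.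
  -- They differ from x and y themselves.
  inside-green : ∀ {x y} → S x ≡ true → S y ≡ true → G x y ≡ true → 11 ≤ # S
  inside-green {x} {y} sx sy gxy = subst (11 ≤_) (+-identityʳ _)
    (≤-trans (manyB x y (edge≢ turned gxy) (R⇒¬G turned gxy) ⊕ #-single≥1 x ⊕ #-single≥1 y ⊕ z≤n)
      (weigh ((λ z → B x z or B y z) ∷ (x ==_) ∷ (y ==_) ∷ []) (S ∷ []) pointwise))
    where
    turned = rotate triple
    pointwise : ∀ z → ⟦ B x z or B y z ⟧ + (⟦ x == z ⟧ + (⟦ y == z ⟧ + 0)) ≤ ⟦ S z ⟧ + 0
    pointwise z with S z in sz
    ... | true  = spine-green (one x z) (one y z) (at {C = G} (trans (symG y x) gxy)) (at {C = G} gxy)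
    ... | false = both-red (one x z) (one y z) (out sx sz) (out sy sz)

  -- As for a green edge, but now nine green and nine blue vertices lie in S, disjoint by `spine`,
  -- besides the two ends.
  inside-red : ∀ {x y} → S x ≡ true → S y ≡ true → R x y ≡ true → 20 ≤ # S
  inside-red {x} {y} sx sy rxy = subst (20 ≤_) (+-identityʳ _)
    (≤-trans (manyG x y (edge≢ triple rxy) (R⇒¬G triple rxy) ⊕
              manyB x y (edge≢ triple rxy) (R⇒¬G (swap triple) rxy) ⊕
              #-single≥1 x ⊕ #-single≥1 y ⊕ z≤n)
      (weigh ((λ z → G x z or G y z) ∷ (λ z → B x z or B y z) ∷ (x ==_) ∷ (y ==_) ∷ []) (S ∷ [])
        pointwise))
    where
    pointwise : ∀ z → ⟦ G x z or G y z ⟧ + (⟦ B x z or B y z ⟧ + (⟦ x == z ⟧ + (⟦ y == z ⟧ + 0))) ≤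
                      ⟦ S z ⟧ + 0
    pointwise z with S z in sz
    ... | true  = ≤-trans (m≤n+m _ ⟦ R x z ∧ R y z ⟧) (spine triple rxy z)
    ... | false = both-red′ (one x z) (one y z) (out sx sz) (out sy sz)

side-size : ∀ {n} {R G B : Relation n} {S} → Side R G B S →
         ∀ {x y} → S x ≡ true → S y ≡ true → (x == y) ≡ false → 11 ≤ # S
side-size s sx sy x≢y with ≢⇒RGB (Side.triple s) x≢y
... | inj₁ rxy        = ≤-trans by≤ (inside-red s sx sy rxy)
... | inj₂ (inj₁ gxy) = inside-green s sx sy gxy
... | inj₂ (inj₂ bxy) = inside-green (swap-side s) sx sy bxy

module _ {n} {R G B : Relation n} {S : Fin n → Bool} (s : Side R G B S)
         (no-red : ∀ {x y} → S x ≡ true → S y ≡ true → R x y ≡ false) where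
  open Side s
  open Triple triple

  red⇔outside : ∀ {x} → S x ≡ true → ∀ z → R x z ≡ not (S z)
  red⇔outside sx z with S z in sz
  ... | true  = no-red sx sz
  ... | false = out sx sz

  degrees : ∀ {v} → S v ≡ true → # G v + (# B v + 1) ≡ # S
  degrees {v} sv = trans (cong (λ k → # G v + (# B v + k)) (sym (trans (+-identityʳ _) (#-single v))))
    (trans (≤-antisym (weigh lhs (S ∷ []) (≤-reflexive ∘ pointwise))
                      (weigh (S ∷ []) lhs (≤-reflexive ∘ sym ∘ pointwise)))
           (+-identityʳ _))
    where
    lhs = G v ∷ B v ∷ (v ==_) ∷ []
    go : ∀ {d r g b s} → One d r g b → r ≡ not s → ⟦ g ⟧ + (⟦ b ⟧ + (⟦ d ⟧ + 0)) ≡ ⟦ s ⟧ + 0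
    go {s = true}  diag  _ = refl
    go {s = true}  green _ = refl
    go {s = true}  blue  _ = refl
    go {s = false} red   _ = refl
    pointwise : ∀ z → sum (weights lhs z) ≡ ⟦ S z ⟧ + 0
    pointwise z = go (one v z) (red⇔outside sv z)

  -- At least nine vertices are seen in blue from u or v, and at most five of them from v.
  new-blue : ∀ {u v} → G v u ≡ true → # B v ≤ 5 → ∃[ w ] B u w ≡ true × B v w ≡ false
  new-blue {u} {v} gvu b≤5 =
    case pick {p = λ z → B u z ∧ not (B v z)} (arith (≤-trans many (weigh (_ ∷ []) (_ ∷ B v ∷ []) pointwise))) of
    λ (w , both) → w , split (B u w) (B v w) both
    where
    many : 9 ≤ # (λ z → B u z or B v z) + 0
    many = ≤-trans (manyB u v (edge≢ turned (trans (symG u v) gvu)) (R⇒¬G turned (trans (symG u v) gvu)))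
                   (≤-reflexive (sym (+-identityʳ _)))
      where turned = rotate triple
    cover : ∀ p q → ⟦ p or q ⟧ + 0 ≤ ⟦ p ∧ not q ⟧ + (⟦ q ⟧ + 0)
    cover true  true  = by≤
    cover true  false = by≤
    cover false _     = ≤-refl
    pointwise : ∀ z → ⟦ B u z or B v z ⟧ + 0 ≤ ⟦ B u z ∧ not (B v z) ⟧ + (⟦ B v z ⟧ + 0)
    pointwise z = cover (B u z) (B v z)
    arith : ∀ {k} → 9 ≤ k + (# B v + 0) → 1 ≤ k
    arith {suc k} _ = s≤s z≤n
    arith {zero} le = ⊥-elim (impossible (≤-trans le (b≤5 ⊕ ≤-refl {0})) 3 refl)
    split : ∀ p q → p ∧ not q ≡ true → p ≡ true × q ≡ false
    split true false _ = refl , refl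

  -- The blue edge uw keeps w inside S, so vw is not red; nor is it blue, and w differs from v
  -- because uv is green.
  third-vertex : ∀ {u v w} → S v ≡ true → G v u ≡ true → B u w ≡ true → B v w ≡ false → G v w ≡ true
  third-vertex {u} {v} {w} sv gvu buw ¬bvw =
    go (one v w) v≢w (trans (red⇔outside sv w) (cong not sw)) ¬bvw
    where
    go : ∀ {d r g b} → One d r g b → d ≡ false → r ≡ false → b ≡ false → g ≡ true
    go green _ _ _ = refl
    su : S u ≡ true
    su with S u in eq′
    ... | true  = refl
    ... | false = case trans (sym (R⇒¬G triple (out sv eq′))) gvu of λ ()
    sw : S w ≡ true
    sw with S w in eq′
    ... | true  = refl
    ... | false = case trans (sym (R⇒¬G (swap triple) (out su eq′))) buw of λ ()
    v≢w : (v == w) ≡ false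
    v≢w = ≢⇒== λ { refl → case trans (sym (R⇒¬G (rotate triple) gvu)) (trans (symB v u) buw) of λ () }

  -- Choose u and w with uv and vw green and uw blue. Count the vertices seen in blue from u or v,
  -- in blue from w or v and in green from u or w, at least nine each, and add u and w. A blue
  -- neighbour of v is counted at most three times, a green one at most twice, v itself at most
  -- once. With g and b the degrees of v this gives 29 ≤ 3b + 2g + 1, whereas 3b + 2g = b + 2(g + b)
  -- ≤ 5 + 22.
  small-side : ∀ {v} → S v ≡ true → # B v ≤ # G v → 11 ≤ # S → # S ≤ 12 → ⊥
  small-side {v} sv B≤G 11≤ ≤12
    with g≥1 , b≤5 ← degree-bounds B≤G (≤-trans 11≤ (≤-reflexive (sym (degrees sv))))
                                (≤-trans (≤-reflexive (degrees sv)) ≤12)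
    with u , gvu ← pick {p = G v} g≥1
    with w , buw , ¬bvw ← new-blue gvu b≤5 =
    impossible
      (≤-trans
        (manyB u v (edge≢ turned guv) (R⇒¬G turned guv) ⊕
         manyB w v (edge≢ turned gwv) (R⇒¬G turned gwv) ⊕
         manyG u w (edge≢ (rotate turned) buw) (R⇒¬G (swap (rotate turned)) buw) ⊕
         #-single≥1 u ⊕ #-single≥1 w ⊕ ≤-refl {# G v + 0})
        (weigh ((λ z → B u z or B v z) ∷ (λ z → B w z or B v z) ∷ (λ z → G u z or G w z) ∷
                (u ==_) ∷ (w ==_) ∷ G v ∷ [])
               (B v ∷ B v ∷ B v ∷ G v ∷ G v ∷ G v ∷ (v ==_) ∷ [])
               pointwise)
       ⊕ b≤5 ⊕ (≤-trans (≤-reflexive (degrees sv)) ≤12) ⊕ (≤-trans (≤-reflexive (degrees sv)) ≤12))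
      0 (trans (arith (# G v) (# B v))
          (cong (λ k → suc (# B v + (# B v + (# B v + (# G v + (# G v + (# G v + (k + 0)))))) + 29 + 0))
                (sym (#-single v))))
    where
    turned = rotate triple
    gvw = third-vertex sv gvu buw ¬bvw
    guv = trans (symG u v) gvu
    gwv = trans (symG w v) gvw
    inS : ∀ {x} → G v x ≡ true → S x ≡ true
    inS {x} gvx with S x in sx
    ... | true  = refl
    ... | false = case trans (sym (R⇒¬G triple (out sv sx))) gvx of λ ()
    arith : ∀ g b → (9 + (9 + (9 + (1 + (1 + (g + 0)))))) + (b + ((g + (b + 1)) + (g + (b + 1)))) ≡
                    suc (b + (b + (b + (g + (g + (g + (1 + 0)))))) + 29 + 0)
    arith = solve-∀
    same-side : ∀ {x} → S x ≡ true → ∀ z → R v z ≡ R x z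
    same-side sx z = trans (red⇔outside sv z) (sym (red⇔outside sx z))
    pointwise : ∀ z →
      ⟦ B u z or B v z ⟧ + (⟦ B w z or B v z ⟧ + (⟦ G u z or G w z ⟧ +
        (⟦ u == z ⟧ + (⟦ w == z ⟧ + (⟦ G v z ⟧ + 0))))) ≤
      ⟦ B v z ⟧ + (⟦ B v z ⟧ + (⟦ B v z ⟧ + (⟦ G v z ⟧ + (⟦ G v z ⟧ + (⟦ G v z ⟧ + (⟦ v == z ⟧ + 0))))))
    pointwise z = green-blue-path (one v z) (one u z) (one w z)
      (same-side (inS gvu) z) (same-side (inS gvw) z)
      (at {C = G} guv) (at {C = G} gwv) (at {C = G} gvu) (at {C = B} (trans (symB w u) buw))
      (at {C = G} gvw) (at {C = B} buw)
-- Joins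

Universal : ∀ {n} → Relation n → Fin n → Set
Universal C y = ∀ z → (y == z) ≡ false → C y z ≡ true

except : ∀ {n} → Fin n → Fin n → Bool
except y z = not (y == z)

record Join {n} (W : Fin n → Bool) (C : Relation n) : Set where
  constructor mkJoin
  field
    side  : Fin n → Bool
    left  : ∃[ a ] W a ≡ true × side a ≡ true
    right : ∃[ b ] W b ≡ true × side b ≡ false
    cross : ∀ {u v} → W u ≡ true → W v ≡ true → side u ≡ true → side v ≡ false → C u v ≡ true

flip-join : ∀ {n} {W} {C : Relation n} → (∀ x y → C x y ≡ C y x) → Join W C → Join W C
flip-join symC (mkJoin S (a , wa , sa) (b , wb , sb) cross) =
  mkJoin (not ∘ S) (b , wb , cong not sb) (a , wa , cong not sa)
    λ {u} {v} wu wv su sv → trans (symC u v) (cross wv wu (not-injective sv) (not-injective su))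

∧-true : ∀ {p q} → p ∧ q ≡ true → p ≡ true × q ≡ true
∧-true {true} {true} _ = refl , refl

∧-false : ∀ {p q} → p ∧ q ≡ false → p ≡ false ⊎ q ≡ false
∧-false {false}        _ = inj₁ refl
∧-false {true} {false} _ = inj₂ refl

not-true : ∀ {p} → not p ≡ true → p ≡ false
not-true {false} _ = refl

not-false : ∀ {p} → not p ≡ false → p ≡ true
not-false {true} _ = refl

bool : ∀ b → b ≡ true ⊎ b ≡ false
bool true  = inj₁ refl
bool false = inj₂ refl

two-members : ∀ {n} {S : Fin n → Bool} → 2 ≤ # S →
              ∃[ x ] ∃[ y ] S x ≡ true × S y ≡ true × (x == y) ≡ false
two-members {S = S} le with φ , inj , sφ ← embed 2 S le =
  φ zero , φ (suc zero) , sφ zero , sφ (suc zero) ,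
  ≢⇒== λ e → case inj e of λ ()

two≤ : ∀ {n} {S : Fin n → Bool} {x y} → S x ≡ true → S y ≡ true → (x == y) ≡ false → 2 ≤ # S
two≤ {S = S} {x} {y} sx sy x≢y = injection⇒# {φ = φ} inj (λ { zero → sx ; (suc zero) → sy })
  where
  φ : Fin 2 → Fin _
  φ zero       = x
  φ (suc zero) = y
  inj : Injective _≡_ _≡_ φ
  inj {zero}     {zero}     _ = refl
  inj {zero}     {suc zero} e = ⊥-elim (==⇒≢ x≢y e)
  inj {suc zero} {zero}     e = ⊥-elim (==⇒≢ x≢y (sym e))
  inj {suc zero} {suc zero} _ = refl

module _ {n} (n≡25 : n ≡ 25) where
  open Order25 n≡25

  -- Both sides have at least 11 vertices and the smaller at most 12. A red edge inside it would
  -- require 20, so `small-side` applies to it, with green and blue exchanged if blue is the more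
  -- frequent at the chosen vertex.
  unbalanced : ∀ {R G B : Relation n} → Triple R G B → (S : Fin n → Bool) →
               (∀ {u v} → S u ≡ true → S v ≡ false → R u v ≡ true) →
               2 ≤ # S → 2 ≤ # (not ∘ S) → ⊥
  unbalanced {R} {G} {B} t S J 2≤S 2≤S′
    with x , x′ , sx , sx′ , x≢x′ ← two-members 2≤S
       | y , y′ , sy , sy′ , y≢y′ ← two-members 2≤S′ =
    smaller (≤-total (# S) (# (not ∘ S)))
    where
    open Triple t
    s : Side R G B S
    s = record { triple = t ; out = J }
    s′ : Side R G B (not ∘ S)
    s′ = record { triple = t ; out = λ {u} {v} su sv → trans (symR u v) (J (not-false sv) (not-true su)) }
    11≤S = side-size s sx sx′ x≢x′
    11≤S′ = side-size s′ sy sy′ y≢y′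
    sum≤ : # S + # (not ∘ S) ≤ 25
    sum≤ = ≤-reflexive (complement S)
    arith : ∀ a b → 11 + 20 + (a + b) ≡ suc (a + b + 25 + 5)
    arith = solve-∀
    no-red : ∀ {S′} → Side R G B S′ → # S′ ≤ 14 → ∀ {u v} → S′ u ≡ true → S′ v ≡ true → R u v ≡ false
    no-red s″ ≤14 {u} {v} su sv with bool (R u v)
    ... | inj₂ e = e
    ... | inj₁ e = ⊥-elim (impossible (≤-trans (inside-red s″ su sv e) ≤14) 5 refl)
    ≤14 : ∀ {a b} → 11 ≤ a → a + b ≤ 25 → b ≤ 14
    ≤14 {b = b} 11≤a le = +-cancelˡ-≤ 11 b 14 (≤-trans (11≤a ⊕ ≤-refl) le)
    ≤12 : ∀ {a b} → a ≤ b → a + b ≤ 25 → a ≤ 12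
    ≤12 {a} {b} a≤b le = ≮⇒≥ λ 13≤a → impossible (≤-trans (13≤a ⊕ ≤-trans 13≤a a≤b) le) 0 refl
    finish : ∀ {S′} (s″ : Side R G B S′) → ∀ {v} → S′ v ≡ true → 11 ≤ # S′ → # S′ ≤ 12 → ⊥
    finish s″ {v} sv 11≤ le with ≤-total (# B v) (# G v)
    ... | inj₁ B≤G = small-side s″ (no-red s″ (≤-trans le by≤)) sv B≤G 11≤ le
    ... | inj₂ G≤B = small-side (swap-side s″) (no-red s″ (≤-trans le by≤)) sv G≤B 11≤ le
    smaller : # S ≤ # (not ∘ S) ⊎ # (not ∘ S) ≤ # S → ⊥
    smaller (inj₁ le) = finish s sx 11≤S (≤12 le sum≤)
    smaller (inj₂ le) = finish s′ sy 11≤S′ (≤12 le (≤-trans (≤-reflexive (+-comm _ (# S))) sum≤))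

  -- By `unbalanced` one side is a single vertex, and that vertex is universal.
  join⇒universal : ∀ {R G B : Relation n} → Triple R G B → Join everything R → ∃[ y ] Universal R y
  join⇒universal {R} t (mkJoin S (a , _ , sa) (b , _ , sb) cross)
    with 2 ≤? # S | 2 ≤? # (not ∘ S)
  ... | yes 2≤S | yes 2≤S′ = ⊥-elim (unbalanced t S (cross refl refl) 2≤S 2≤S′)
  ... | no ¬2≤S | _ = a , λ z a≢z → cross refl refl sa (lone z a≢z)
    where
    lone : ∀ z → (a == z) ≡ false → S z ≡ false
    lone z a≢z with bool (S z)
    ... | inj₁ sz = ⊥-elim (¬2≤S (two≤ sa sz a≢z))
    ... | inj₂ sz = sz
  ... | _ | no ¬2≤S′ = b , λ z b≢z → trans (Triple.symR t b z) (cross refl refl (lone z b≢z) sb)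
    where
    lone : ∀ z → (b == z) ≡ false → S z ≡ true
    lone z b≢z with bool (S z)
    ... | inj₁ sz = sz
    ... | inj₂ sz = ⊥-elim (¬2≤S′ (two≤ (cong not sb) (cong not sz) b≢z))

  module _ {R G B : Relation n} (t : Triple R G B) {y : Fin n} (uy : Universal R y) where
    open Triple t

    -- Since y is joined to everything in red, it can be added to either side. A side of the join is
    -- then opposed to at least two vertices, one from the other side and y, so by `unbalanced` it
    -- is a single vertex. That leaves three vertices in all.
    no-red-join : Join (except y) R → ⊥
    no-red-join j = impossible
      (≤-trans (weigh (everything ∷ [])
                 (restrict j ∷ restrict j′ ∷ (y ==_) ∷ []) pointwise)
               (at-most-one j ⊕ at-most-one j′ ⊕ ≤-reflexive (#-single y) ⊕ ≤-refl))
      21 total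
      where
      j′ = flip-join symR j
      restrict : Join (except y) R → Fin n → Bool
      restrict j z = Join.side j z ∧ except y z
      at-most-one : ∀ j → # (restrict j) ≤ 1
      at-most-one j@(mkJoin S (a , wa , sa) (b , wb , sb) cross) = ≮⇒≥ λ 2≤ →
        unbalanced t (restrict j) J 2≤ (two≤ {y = y} outside-b outside-y (≢⇒== λ e → ==⇒≢ (not-true wb) (sym e)))
        where
        outside-b : not (S b ∧ except y b) ≡ true
        outside-b rewrite sb = refl
        outside-y : not (S y ∧ except y y) ≡ true
        outside-y rewrite ==-refl y with S y
        ... | true  = refl
        ... | false = refl
        J : ∀ {u v} → S u ∧ except y u ≡ true → S v ∧ except y v ≡ false → R u v ≡ true
        J {u} {v} pu pv with su , wu ← ∧-true pu with bool (except y v)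
        ... | inj₂ wv = subst (λ v → R u v ≡ true) (==⇒≡ (not-false wv)) (trans (symR u y) (uy u (not-true wu)))
        ... | inj₁ wv with ∧-false pv
        ...   | inj₁ sv  = cross wu wv su sv
        ...   | inj₂ ¬wv = case trans (sym wv) ¬wv of λ ()
      go : ∀ s d → 1 ≤ ⟦ s ∧ not d ⟧ + (⟦ not s ∧ not d ⟧ + (⟦ d ⟧ + 0))
      go true  true  = by≤
      go true  false = by≤
      go false true  = by≤
      go false false = by≤
      pointwise : ∀ z → 1 ≤ ⟦ restrict j z ⟧ + (⟦ restrict j′ z ⟧ + (⟦ y == z ⟧ + 0))
      pointwise z = go (Join.side j z) (y == z)

    -- The edge xy is red and y has no blue neighbour, so all nine vertices given by `manyB` are
    -- seen from x.
    blue-degree : ∀ {x} → (y == x) ≡ false → 9 ≤ # B x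
    blue-degree {x} y≢x = subst₂ _≤_ refl (+-identityʳ _)
      (≤-trans (≤-trans (manyB x y (≢⇒== λ e → ==⇒≢ y≢x (sym e)) not-blue) (≤-reflexive (sym (+-identityʳ _))))
        (weigh ((λ z → B x z or B y z) ∷ []) (B x ∷ []) λ z → go (one y z) (uy z) (B x z)))
      where
      not-blue : B x y ≡ false
      not-blue = trans (symB x y) (R⇒¬G (swap t) (uy x y≢x))
      go : ∀ {d r g b} → One d r g b → (d ≡ false → r ≡ true) → ∀ b′ → ⟦ b′ or b ⟧ + 0 ≤ ⟦ b′ ⟧ + 0
      go diag  p true  = ≤-refl
      go diag  p false = ≤-refl
      go red   p true  = ≤-refl
      go red   p false = ≤-refl
      go green p _ = case p refl of λ ()
      go blue  p _ = case p refl of λ ()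

    -- Blue edges stay within a side, as y is red to everything and the sides are joined in green. A
    -- blue edge in a side has ends of blue degree at least nine with at most five common blue
    -- neighbours, so each side has at least 9 + 9 - 5 = 13 vertices; with y this exceeds 25.
    no-green-join : Join (except y) G → ⊥
    no-green-join j@(mkJoin S _ _ _) =
      impossible (≤-trans (large j ⊕ large j′ ⊕ ≤-refl {1}) sum≤) 1 refl
      where
      j′ = flip-join symG j
      part : Join (except y) G → Fin n → Bool
      part j z = Join.side j z ∧ except y z
      sum≤ : # (part j) + (# (part j′) + 1) ≤ 25
      sum≤ = subst₂ (λ a b → # (part j) + (# (part j′) + a) ≤ b) (trans (+-identityʳ _) (#-single y)) total
        (weigh (part j ∷ part j′ ∷ (y ==_) ∷ []) (everything ∷ []) λ z → go (S z) (y == z))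
        where
        go : ∀ s d → ⟦ s ∧ not d ⟧ + (⟦ not s ∧ not d ⟧ + (⟦ d ⟧ + 0)) ≤ 1
        go true  true  = by≤
        go true  false = by≤
        go false true  = by≤
        go false false = by≤
      large : ∀ j → 13 ≤ # (part j)
      large j@(mkJoin S (a , wa , sa) _ cross) = ≰⇒> λ ≤12 →
        case pick {p = B a} (≤-trans by≤ (blue-degree (not-true wa))) of λ (a′ , baa′) →
        let wa′ = stays wa baa′
            ba′a = trans (symB a′ a) baa′ in
        impossible (≤-trans (blue-degree (not-true wa) ⊕ blue-degree (not-true wa′) ⊕ ≤-refl {0})
                     (≤-trans (weigh (B a ∷ B a′ ∷ []) (part j ∷ (λ z → B a z ∧ B a′ z) ∷ [])
                                λ z → go (B a z) (B a′ z) (part j z) (closed wa sa) (closed wa′ (keeps wa sa baa′)))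
                       (≤12 ⊕ monochromatic-pages (rotate (rotate t)) baa′ ⊕ ≤-refl)))
                   0 refl
        where
        stays : ∀ {x z} → except y x ≡ true → B x z ≡ true → except y z ≡ true
        stays {x} {z} wx bxz with bool (except y z)
        ... | inj₁ wz  = wz
        ... | inj₂ ¬wz = case trans (sym bxz) (trans (symB x z) (R⇒¬G (swap t) ryx)) of λ ()
          where ryx = subst (λ w → R w x ≡ true) (==⇒≡ (not-false ¬wz)) (uy x (not-true wx))
        keeps : ∀ {x z} → except y x ≡ true → S x ≡ true → B x z ≡ true → S z ≡ true
        keeps {x} {z} wx sx bxz with bool (S z)
        ... | inj₁ sz = sz
        ... | inj₂ sz = case trans (sym bxz) (R⇒¬G (rotate t) (cross wx (stays wx bxz) sx sz)) of λ ()
        closed : ∀ {x z} → except y x ≡ true → S x ≡ true → B x z ≡ true → S z ∧ except y z ≡ true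
        closed wx sx bxz rewrite keeps wx sx bxz = stays wx bxz
        go : ∀ b b′ s → (b ≡ true → s ≡ true) → (b′ ≡ true → s ≡ true) →
             ⟦ b ⟧ + (⟦ b′ ⟧ + 0) ≤ ⟦ s ⟧ + (⟦ b ∧ b′ ⟧ + 0)
        go true  true  true  _ _ = by≤
        go true  true  false p _ = case p refl of λ ()
        go true  false true  _ _ = by≤
        go true  false false p _ = case p refl of λ ()
        go false true  true  _ _ = by≤
        go false true  false _ p = case p refl of λ ()
        go false false _     _ _ = z≤n
-- Gallai colourings have a disconnected colour

-- `minimal` is the induction principle of connectivity and stands in for walks: a property is
-- carried over a component by an equivalence that respects edges.
record Components {n} (_~_ : Rel (Fin n) 0ℓ) : Set₁ where
  field
    label   : Fin n → Fin n
    merged  : ∀ {u v} → u ~ v → label u ≡ label v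
    minimal : ∀ {_≈_ : Rel (Fin n) 0ℓ} → IsEquivalence _≈_ → (∀ {u v} → u ~ v → u ≈ v) →
              ∀ {u v} → label u ≡ label v → u ≈ v

-- Starting from singletons, the edges of a finite list are processed one by one, each giving the
-- class of one end the label of the other.
components : ∀ {n} {_~_ : Rel (Fin n) 0ℓ} → Decidable _~_ → Components _~_
components {n} {_~_} _~?_ = record
  { label   = label
  ; merged  = λ {u} {v} u~v → merged (∈-filter⁺ edge? (∈-cartesianProduct⁺ (∈-allFin u) (∈-allFin v)) u~v)
  ; minimal = λ eq ~⇒≈ → minimal eq λ e∈ → ~⇒≈ (proj₂ (∈-filter⁻ edge? {xs = pairs} e∈))
  }
  where
  pairs = cartesianProduct (allFin n) (allFin n)
  edge? = λ (e : Fin n × Fin n) → proj₁ e ~? proj₂ e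
  record Merged (es : List (Fin n × Fin n)) : Set₁ where
    field
      label   : Fin n → Fin n
      merged  : ∀ {u v} → (u , v) ∈ˡ es → label u ≡ label v
      minimal : ∀ {_≈_ : Rel (Fin n) 0ℓ} → IsEquivalence _≈_ → (∀ {u v} → (u , v) ∈ˡ es → u ≈ v) →
                ∀ {u v} → label u ≡ label v → u ≈ v
  merge : ∀ es → Merged es
  merge [] = record
    { label   = λ z → z
    ; merged  = λ ()
    ; minimal = λ eq _ → λ { refl → IsEquivalence.refl eq }
    }
  merge ((a , b) ∷ es) = record
    { label   = relabel ∘ label
    ; merged  = λ { (here refl) → trans (relabel-a (label a) refl) (sym relabel-b)
                  ; (there e∈)  → cong relabel (merged e∈) }
    ; minimal = min
    }
    where
    open Merged (merge es)
    relabel : Fin n → Fin n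
    relabel k with k ≟ label a
    ... | yes _ = label b
    ... | no  _ = k
    relabel-a : ∀ k → k ≡ label a → relabel k ≡ label b
    relabel-a k e with k ≟ label a
    ... | yes _ = refl
    ... | no ≢ = contradiction e ≢
    relabel-b : relabel (label b) ≡ label b
    relabel-b with label b ≟ label a
    ... | yes _ = refl
    ... | no  _ = refl
    min : ∀ {_≈_ : Rel (Fin n) 0ℓ} → IsEquivalence _≈_ → (∀ {u v} → (u , v) ∈ˡ ((a , b) ∷ es) → u ≈ v) →
          ∀ {u v} → relabel (label u) ≡ relabel (label v) → u ≈ v
    min {_≈_} eq es⇒≈ {u} {v} e with label u ≟ label a | label v ≟ label a
    ... | yes ua | yes va = minimal eq (es⇒≈ ∘ there) (trans ua (sym va))
    ... | no _   | no _   = minimal eq (es⇒≈ ∘ there) e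
    ... | yes ua | no _   = E.trans (old ua) (E.trans (es⇒≈ (here refl)) (old e))
      where
      module E = IsEquivalence eq
      old = minimal eq (es⇒≈ ∘ there)
    ... | no _ | yes va = E.trans (old e) (E.sym (E.trans (old va) (es⇒≈ (here refl))))
      where
      module E = IsEquivalence eq
      old = minimal eq (es⇒≈ ∘ there)
  open Merged (merge (filter edge? pairs))

_∈ˡ?_ : ∀ {n} → Decidable (_∈ˡ_ {A = Fin n})
_∈ˡ?_ = _∈?_ _≟_

record Cut {n} (P : Fin n → Set) (C : Relation n) : Set where
  constructor mkCut
  field
    side   : Fin n → Bool
    left   : ∃[ a ] P a × side a ≡ true
    right  : ∃[ b ] P b × side b ≡ false
    across : ∀ {u v} → P u → P v → side u ≡ true → side v ≡ false → C u v ≡ false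

-- The components of the colour R on the vertices satisfying P.
record Split {n} (R G B : Relation n) (P : Fin n → Set) : Set₁ where
  field
    triple : Triple R G B
    label  : Fin n → Fin n
    far    : ∀ {u v} → P u → P v → label u ≢ label v → R u v ≡ false
    homG   : ∀ {u u′ v} → P v → label u ≡ label u′ → label u ≢ label v → G u v ≡ G u′ v
    homB   : ∀ {u u′ v} → P v → label u ≡ label u′ → label u ≢ label v → B u v ≡ B u′ v
    cutℓ   : Cut P R → ∃[ a ] ∃[ b ] P a × P b × label a ≢ label b

-- Moving along a red edge cannot change the colour towards v from green to blue, since that would
-- be a rainbow triangle; `minimal` extends this to the whole component.
homogeneous : ∀ {n} {R G B : Relation n} → Triple R G B → {P : Fin n → Set}
  (c : Components (λ u v → P u × P v × R u v ≡ true)) → let open Components c in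
  ∀ {u u′ v} → P v → label u ≡ label u′ → label u ≢ label v → G u v ≡ G u′ v
homogeneous {R = R} {G} {B} t {P} c {u} {u′} {v} pv ℓ≡ ℓ≢ = proj₂ (minimal equivalence step ℓ≡) ℓ≢
  where
  open Triple t
  open Components c
  -- Equality of labels is included so that the premise of the implication passes from one vertex to
  -- the other.
  _≈_ : Rel _ 0ℓ
  x ≈ y = label x ≡ label y × (label x ≢ label v → G x v ≡ G y v)
  equivalence : IsEquivalence _≈_
  equivalence = record
    { refl  = refl , λ _ → refl
    ; sym   = λ (e , h) → sym e , λ y≢ → sym (h λ x≡ → y≢ (trans (sym e) x≡))
    ; trans = λ (e , h) (e′ , h′) → trans e e′ , λ x≢ → trans (h x≢) (h′ λ y≡ → x≢ (trans e y≡))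
    }
  go : ∀ {d r g b d′ r′ g′ b′} → One d r g b → One d′ r′ g′ b′ → d ≡ false → d′ ≡ false →
       r ≡ false → r′ ≡ false → (g ≡ true → b′ ≡ true → ⊥) → (b ≡ true → g′ ≡ true → ⊥) → g ≡ g′
  go green green _ _ _ _ _ _ = refl
  go green blue  _ _ _ _ p _ = ⊥-elim (p refl refl)
  go blue  green _ _ _ _ _ p = ⊥-elim (p refl refl)
  go blue  blue  _ _ _ _ _ _ = refl
  step : ∀ {x y} → P x × P y × R x y ≡ true → x ≈ y
  step {x} {y} (px , py , rxy) = merged (px , py , rxy) , λ x≢ →
    let y≢ = λ e → x≢ (trans (merged (px , py , rxy)) e) in
    go (one x v) (one y v) (≢⇒== λ e → x≢ (cong label e)) (≢⇒== λ e → y≢ (cong label e))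
       (separate px x≢) (separate py y≢)
       (λ gxv byv → gallai x y v rxy gxv byv)
       (λ bxv gyv → gallai y x v (trans (symR y x) rxy) gyv bxv)
    where
    separate : ∀ {x} → P x → label x ≢ label v → R x v ≡ false
    separate {x} px x≢ with bool (R x v)
    ... | inj₁ rxv = contradiction (merged (px , pv , rxv)) x≢
    ... | inj₂ e   = e

split : ∀ {n} {R G B : Relation n} → Triple R G B → {P : Fin n → Set} → (∀ z → Dec (P z)) → Split R G B P
split {n} {R} {G} {B} t {P} P? = record
  { triple = t
  ; label = label
  ; far  = λ {u} {v} pu pv ≢ → case bool (R u v) of λ
      { (inj₁ r) → contradiction (merged (pu , pv , r)) ≢ ; (inj₂ e) → e }
  ; homG = homogeneous t c
  ; homB = homogeneous (swap t) c
  -- The side of a cut is constant along red edges, hence by `minimal` on components, so vertices on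
  -- different sides have different labels.
  ; cutℓ = λ (mkCut S (a , pa , sa) (b , pb , sb) across) → a , b , pa , pb , λ e →
      case trans (sym sa) (trans (minimal {_≈_ = λ x y → S x ≡ S y}
        (record { refl = refl ; sym = sym ; trans = trans }) (λ {u} {v} (pu , pv , r) → same S across pu pv r) e) sb)
      of λ ()
  }
  where
  c = components (λ u v → P? u ×-dec P? v ×-dec (R u v ≟ᵇ true))
  open Components c
  same : ∀ (S : Fin n → Bool) → (∀ {u v} → P u → P v → S u ≡ true → S v ≡ false → R u v ≡ false) →
         ∀ {u v} → P u → P v → R u v ≡ true → S u ≡ S v
  same S across {u} {v} pu pv r with S u in su | S v in sv
  ... | true  | true  = refl
  ... | false | false = refl
  ... | true  | false = case trans (sym r) (across pu pv su sv) of λ ()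
  ... | false | true  = case trans (sym r) (trans (Triple.symR t u v) (across pv pu sv su)) of λ ()

swap-split : ∀ {n} {R G B : Relation n} {P} → Split R G B P → Split R B G P
swap-split s = record { triple = swap triple ; label = label ; far = far ; homG = homB ; homB = homG ; cutℓ = cutℓ }
  where open Split s

far≢ : ∀ {n} {R G B : Relation n} {P} (s : Split R G B P) → let open Split s in
       ∀ {u v} → label u ≢ label v → (u == v) ≡ false
far≢ s ≢ = ≢⇒== λ e → ≢ (cong (Split.label s) e)

AnyCut : ∀ {n} (R G B : Relation n) → (Fin n → Set) → Set
AnyCut R G B P = Cut P R ⊎ Cut P G ⊎ Cut P B

-- Red is excluded between components, and blue would make the triangle on v, g and q rainbow.
far-green : ∀ {n} {R G B : Relation n} {P} (s : Split R G B P) → let open Split s in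
            ∀ {v g q} → P g → P q → G v g ≡ true → R v q ≡ true → label g ≢ label q → G g q ≡ true
far-green {R = R} {G} {B} s {v} {g} {q} pg pq gvg rvq ℓ≢ =
  go (one g q) (far≢ s ℓ≢) (far pg pq ℓ≢) λ bgq → gallai v q g rvq gvg (trans (symB q g) bgq)
  where
  open Split s
  open Triple triple
  go : ∀ {d r g b} → One d r g b → d ≡ false → r ≡ false → (b ≡ true → ⊥) → g ≡ true
  go green _ _ _ = refl
  go blue  _ _ p = ⊥-elim (p refl)

-- If g and h lie in different components, `far-green` makes g green to a red neighbour of v near h,
-- and h blue to one near g, although the two components are joined in one colour. If they share a
-- component, g and h see a red neighbour of v in another component in green and in blue, against
-- homogeneity.
rainbow-vertex : ∀ {n} {R G B : Relation n} {P} (s : Split R G B P) → let open Split s in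
  ∀ {v a b g h} → P a → P b → label a ≢ label b → P g → G v g ≡ true → P h → B v h ≡ true →
  (∀ {p} → P p → ∃[ q ] P q × label q ≡ label p × R v q ≡ true) → ⊥
rainbow-vertex {R = R} {G} {B} {P} s {v} {a} {b} {g} {h} pa pb a≢b pg gvg ph bvh reach =
  case label h ≟ label g of λ
    { (no h≢g) →
        let q , pq , q~g , rvq = reach pg
            q′ , pq′ , q′~h , rvq′ = reach ph
            ggq′ = far-green s pg pq′ gvg rvq′ λ e → h≢g (sym (trans e q′~h))
            bhq  = far-green (swap-split s) ph pq bvh rvq λ e → h≢g (trans e q~g)
            gqq′ = trans (sym (homG pq′ (sym q~g) λ e → h≢g (sym (trans e q′~h)))) ggq′
            ghq  = trans (sym (homG pq q′~h λ e → h≢g (trans (sym q′~h) (trans e q~g)))) (trans (symG q′ q) gqq′)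
        in not-both ghq bhq
    ; (yes h~g) →
        let c , pc , g≢c = other
            q , pq , q~c , rvq = reach pc
            g≢q = λ e → g≢c (trans e q~c)
        in not-both (trans (sym (homG pq (sym h~g) g≢q)) (far-green s pg pq gvg rvq g≢q))
                    (far-green (swap-split s) ph pq bvh rvq λ e → g≢q (trans (sym h~g) e))
    }
  where
  open Split s
  open Triple triple
  not-both : ∀ {x y} → G x y ≡ true → B x y ≡ true → ⊥
  not-both gxy bxy = case trans (sym bxy) (R⇒¬G (rotate triple) gxy) of λ ()
  other : ∃[ c ] P c × label g ≢ label c
  other with label g ≟ label a
  ... | no g≢a  = a , pa , g≢a
  ... | yes g~a = b , pb , λ e → a≢b (trans (sym g~a) e)

isolated-cut : ∀ {n} {C : Relation n} {xs v a} → ¬ v ∈ˡ xs → a ∈ˡ xs →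
               (∀ {w} → w ∈ˡ xs → C v w ≢ true) → Cut (_∈ˡ (v ∷ xs)) C
isolated-cut {C = C} {xs} {v} {a} v∉ a∈ none =
  mkCut (v ==_) (v , here refl , ==-refl v) (a , there a∈ , ≢⇒== λ { refl → v∉ a∈ }) across
  where
  across : ∀ {u w} → u ∈ˡ (v ∷ xs) → w ∈ˡ (v ∷ xs) → (v == u) ≡ true → (v == w) ≡ false → C u w ≡ false
  across {w = w} _ w∈ v=u v≢w with refl ← ==⇒≡ v=u with w∈
  ... | here refl = contradiction refl (==⇒≢ v≢w)
  ... | there w∈′ = case bool (C v w) of λ
    { (inj₁ e) → contradiction e (none w∈′) ; (inj₂ e) → e }

-- A red component that v does not see in red remains cut off. If v sees every component in red,
-- `rainbow-vertex` leaves v without green or without blue edges, so v is isolated in that colour.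
extend-cut : ∀ {n} {R G B : Relation n} → Triple R G B → ∀ {xs v} → ¬ v ∈ˡ xs →
             Cut (_∈ˡ xs) R → AnyCut R G B (_∈ˡ (v ∷ xs))
extend-cut {n} {R} {G} {B} t {xs} {v} v∉ cut
  with s ← split t {P = _∈ˡ xs} (λ z → z ∈ˡ? xs)
  with a , b , a∈ , b∈ , a≢b ← Split.cutℓ s cut
  with any? (λ p → p ∈ˡ? xs ×-dec
                   ¬? (any? λ q → q ∈ˡ? xs ×-dec (Split.label s q ≟ Split.label s p) ×-dec (R v q ≟ᵇ true)))
... | yes (p , p∈ , unreached) = inj₁ (mkCut side (p , there p∈ , left) (v , here refl , right) across)
  where
  open Split s
  side : Fin n → Bool
  -- `label` is defined at v too, though v lies outside xs, so v is excluded explicitly.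
  side z = (label z == label p) ∧ not (v == z)
  left : side p ≡ true
  left rewrite ==-refl (label p) | ≢⇒== {x = v} {p} (λ { refl → v∉ p∈ }) = refl
  right : side v ≡ false
  right rewrite ==-refl v with label v == label p
  ... | true  = refl
  ... | false = refl
  across : ∀ {x w} → x ∈ˡ (v ∷ xs) → w ∈ˡ (v ∷ xs) → side x ≡ true → side w ≡ false → R x w ≡ false
  across {x} {w} x∈ w∈ sx sw with ℓx , v≢x ← ∧-true {label x == label p} sx with x∈ | w∈
  ... | here refl | _         = contradiction refl (==⇒≢ (not-true v≢x))
  ... | there x∈′ | here refl = case bool (R x v) of λ
    { (inj₁ rxv) → contradiction (x , x∈′ , ==⇒≡ ℓx , trans (Triple.symR t v x) rxv) unreached
    ; (inj₂ e)   → e }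
  ... | there x∈′ | there w∈′ = far x∈′ w∈′ λ e → case trans (sym sw) (inside-p e) of λ ()
    where
    inside-p : label x ≡ label w → side w ≡ true
    inside-p e rewrite sym e | ℓx | ≢⇒== {x = v} {w} (λ { refl → v∉ w∈′ }) = refl
... | no all-reached
  with any? (λ g → g ∈ˡ? xs ×-dec (G v g ≟ᵇ true)) | any? (λ h → h ∈ˡ? xs ×-dec (B v h ≟ᵇ true))
...   | yes (g , g∈ , gvg) | yes (h , h∈ , bvh) =
  ⊥-elim (rainbow-vertex s a∈ b∈ a≢b g∈ gvg h∈ bvh λ {p} p∈ →
    decidable-stable (any? λ q → q ∈ˡ? xs ×-dec (Split.label s q ≟ Split.label s p) ×-dec (R v q ≟ᵇ true))
      λ unreached → all-reached (p , p∈ , unreached))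
...   | no ∄g | _ = inj₂ (inj₁ (isolated-cut v∉ a∈ λ w∈ e → ∄g (_ , w∈ , e)))
...   | _ | no ∄h = inj₂ (inj₂ (isolated-cut v∉ a∈ λ w∈ e → ∄h (_ , w∈ , e)))

discard : ∀ {n} {u v : Fin n} {xs} → v ∈ˡ xs → u ∈ˡ (v ∷ xs) → u ∈ˡ xs
discard v∈ (here refl) = v∈
discard v∈ (there u∈)  = u∈

grow-cut : ∀ {n} {C : Relation n} {xs v} → v ∈ˡ xs → Cut (_∈ˡ xs) C → Cut (_∈ˡ (v ∷ xs)) C
grow-cut {xs = xs} {v} v∈ (mkCut S (a , a∈ , sa) (b , b∈ , sb) across) =
  mkCut S (a , there a∈ , sa) (b , there b∈ , sb) λ u∈ w∈ → across (discard v∈ u∈) (discard v∈ w∈)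

-- Gallai's theorem on disconnected colours, for three colours of which some may be absent. Vertices
-- are added one at a time, and `extend-cut` passes on a cut of the rest, perhaps in another colour;
-- a repeated vertex changes nothing.
disconnected : ∀ {n} {R G B : Relation n} → Triple R G B → ∀ xs {a b} → a ∈ˡ xs → b ∈ˡ xs →
               (a == b) ≡ false → AnyCut R G B (_∈ˡ xs)
disconnected {n} {R} {G} {B} t (v ∷ xs) {a} {b} a∈ b∈ a≢b with v ∈ˡ? xs
... | yes v∈ = case disconnected t xs (discard v∈ a∈) (discard v∈ b∈) a≢b of λ
  { (inj₁ c) → inj₁ (grow-cut v∈ c)
  ; (inj₂ (inj₁ c)) → inj₂ (inj₁ (grow-cut v∈ c))
  ; (inj₂ (inj₂ c)) → inj₂ (inj₂ (grow-cut v∈ c)) }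
... | no v∉ with any? (λ x → any? λ y → x ∈ˡ? xs ×-dec y ∈ˡ? xs ×-dec ((x == y) ≟ᵇ false))
...   | yes (x , y , x∈ , y∈ , x≢y) = case disconnected t xs x∈ y∈ x≢y of λ
  { (inj₁ c) → extend-cut t v∉ c
  ; (inj₂ (inj₁ c)) → case extend-cut (rotate t) v∉ c of λ
      { (inj₁ d) → inj₂ (inj₁ d) ; (inj₂ (inj₁ d)) → inj₂ (inj₂ d) ; (inj₂ (inj₂ d)) → inj₁ d }
  ; (inj₂ (inj₂ c)) → case extend-cut (rotate (rotate t)) v∉ c of λ
      { (inj₁ d) → inj₂ (inj₂ d) ; (inj₂ (inj₁ d)) → inj₁ d ; (inj₂ (inj₂ d)) → inj₂ (inj₁ d) } }
-- Only one further vertex, so one of red and green does not occur.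
...   | no ∄ = case bool (R v w) of λ
  { (inj₂ ¬rvw) → inj₁ (isolated-cut v∉ w∈ λ w′∈ e →
      case trans (sym e) (subst (λ u → R v u ≡ false) (sole w′∈) ¬rvw) of λ ())
  ; (inj₁ rvw)  → inj₂ (inj₁ (isolated-cut v∉ w∈ λ w′∈ e →
      case trans (sym e) (subst (λ u → G v u ≡ false) (sole w′∈) (R⇒¬G t rvw)) of λ ())) }
  where
  another : a ∈ˡ (v ∷ xs) → b ∈ˡ (v ∷ xs) → ∃[ w ] w ∈ˡ xs
  another (there a∈) _ = a , a∈
  another (here refl) (there b∈) = b , b∈
  another (here refl) (here refl) = contradiction refl (==⇒≢ a≢b)
  w = proj₁ (another a∈ b∈)
  w∈ = proj₂ (another a∈ b∈)
  sole : ∀ {w′} → w′ ∈ˡ xs → w ≡ w′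
  sole {w′} w′∈ = case bool (w == w′) of λ
    { (inj₁ e) → ==⇒≡ e ; (inj₂ ≢) → contradiction (w , w′ , w∈ , w′∈ , ≢) ∄ }
-- The reduced colouring on the components

-- W is either everything or everything but one vertex; Y collects the vertices
-- outside W that are joined to W in red.
record Layout {n} (R G B : Relation n) : Set₁ where
  field
    W Y    : Fin n → Bool
    comps  : Split R G B (λ z → W z ≡ true)
    Y⇒¬W   : ∀ {z} → Y z ≡ true → W z ≡ false
    joined : ∀ {x z} → W x ≡ true → Y z ≡ true → R x z ≡ true
    apart  : ∀ {x z} → W x ≡ true → W z ≡ false → Y z ≡ false → R x z ≡ false
    W≥24   : 24 ≤ # W
    noG    : Join W G → ⊥
    noB    : Join W B → ⊥

swap-layout : ∀ {n} {R G B : Relation n} → Layout R G B → Layout R B G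
swap-layout l = record
  { W = W ; Y = Y ; comps = swap-split comps ; Y⇒¬W = Y⇒¬W ; joined = joined ; apart = apart
  ; W≥24 = W≥24 ; noG = noB ; noB = noG }
  where open Layout l

-- This and the next three are the case tables of `middle`, by the place of z: outside W, in the
-- component of x, in one of the two components seen in green, elsewhere in W.
pages-outside : ∀ {d r g b d′ r′ g′ b′ y} → One d r g b → One d′ r′ g′ b′ → d ≡ false → d′ ≡ false →
                (y ≡ true → r ≡ true) → (y ≡ true → r′ ≡ true) →
                ⟦ d ⟧ + (⟦ d′ ⟧ + (⟦ b or b′ ⟧ + (⟦ y ⟧ + 0))) ≤ 1
pages-outside {y = true}  red   red   _ _ _ _ = by≤
pages-outside {y = true}  green _     _ _ p _ = case p refl of λ ()
pages-outside {y = true}  blue  _     _ _ p _ = case p refl of λ ()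
pages-outside {y = true}  red   green _ _ _ p = case p refl of λ ()
pages-outside {y = true}  red   blue  _ _ _ p = case p refl of λ ()
pages-outside {y = false} red   red   _ _ _ _ = by≤
pages-outside {y = false} red   green _ _ _ _ = by≤
pages-outside {y = false} red   blue  _ _ _ _ = by≤
pages-outside {y = false} green red   _ _ _ _ = by≤
pages-outside {y = false} green green _ _ _ _ = by≤
pages-outside {y = false} green blue  _ _ _ _ = by≤
pages-outside {y = false} blue  red   _ _ _ _ = by≤
pages-outside {y = false} blue  green _ _ _ _ = by≤
pages-outside {y = false} blue  blue  _ _ _ _ = by≤

pages-same : ∀ {d r g b d′ r′ g′ b′} → One d r g b → One d′ r′ g′ b′ →
             (d ≡ true → r′ ≡ true) → (d′ ≡ true → r ≡ true) →
             ⟦ d ⟧ + (⟦ d′ ⟧ + (⟦ b or b′ ⟧ + (⟦ r ⟧ + (⟦ r′ ⟧ + 0)))) ≤ 2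
pages-same diag  diag  p _ = case p refl of λ ()
pages-same diag  red   _ _ = by≤
pages-same diag  green p _ = case p refl of λ ()
pages-same diag  blue  p _ = case p refl of λ ()
pages-same red   diag  _ _ = by≤
pages-same red   red   _ _ = by≤
pages-same red   green _ _ = by≤
pages-same red   blue  _ _ = by≤
pages-same green diag  _ p = case p refl of λ ()
pages-same green red   _ _ = by≤
pages-same green green _ _ = by≤
pages-same green blue  _ _ = by≤
pages-same blue  diag  _ p = case p refl of λ ()
pages-same blue  red   _ _ = by≤
pages-same blue  green _ _ = by≤
pages-same blue  blue  _ _ = by≤

pages-green : ∀ {d r g b d′ r′ g′ b′} → One d r g b → One d′ r′ g′ b′ → g ≡ true → g′ ≡ true →
              ⟦ d ⟧ + (⟦ d′ ⟧ + (⟦ b or b′ ⟧ + (⟦ r ⟧ + (⟦ r′ ⟧ + 0)))) ≤ 0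
pages-green green green _ _ = by≤

pages-far : ∀ {d r g b d′ r′ g′ b′} → One d r g b → One d′ r′ g′ b′ →
            d ≡ false → d′ ≡ false → r ≡ false → r′ ≡ false →
            ⟦ d ⟧ + (⟦ d′ ⟧ + (⟦ b or b′ ⟧ + (⟦ r ⟧ + (⟦ r′ ⟧ + 0)))) ≤ 1
pages-far green green _ _ _ _ = by≤
pages-far green blue  _ _ _ _ = by≤
pages-far blue  green _ _ _ _ = by≤
pages-far blue  blue  _ _ _ _ = by≤

record Quad {n} (W : Fin n → Bool) (label : Fin n → Fin n) (a b c d : Fin n) : Set where
  field
    wa : W a ≡ true
    wb : W b ≡ true
    wc : W c ≡ true
    wd : W d ≡ true
    ab : label a ≢ label b
    ac : label a ≢ label c
    ad : label a ≢ label d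
    bc : label b ≢ label c
    bd : label b ≢ label d
    cd : label c ≢ label d

turn-quad : ∀ {n W label} {a b c d : Fin n} → Quad W label a b c d → Quad W label b c d a
turn-quad q = record { wa = wb ; wb = wc ; wc = wd ; wd = wa
                     ; ab = bc ; ac = bd ; ad = ab ∘ sym ; bc = cd ; bd = ac ∘ sym ; cd = ad ∘ sym }
  where open Quad q

turn-last : ∀ {n W label} {a b c d : Fin n} → Quad W label a b c d → Quad W label a c d b
turn-last q = record { wa = wa ; wb = wc ; wc = wd ; wd = wb
                     ; ab = ac ; ac = ad ; ad = ab ; bc = cd ; bd = bc ∘ sym ; cd = bd ∘ sym }
  where open Quad q

module _ {n} {R G B : Relation n} (l : Layout R G B) where
  open Layout l
  open Split comps
  open Triple triple

  infix 4 _≁_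
  _≁_ : Fin n → Fin n → Set
  x ≁ y = label x ≢ label y

  class : Fin n → Fin n → Bool
  class x z = W z ∧ (label x == label z)

  redN : Fin n → Fin n → Bool
  redN x z = W z ∧ R x z

  near : ∀ {x z} → W x ≡ true → W z ≡ true → R x z ≡ true → label x ≡ label z
  near {x} {z} wx wz rxz = decidable-stable (label x ≟ label z) λ ≢ →
    case trans (sym rxz) (far wx wz ≢) of λ ()

  colour-far : ∀ {x y} → W x ≡ true → W y ≡ true → x ≁ y → G x y ≡ true ⊎ B x y ≡ true
  colour-far wx wy x≁y with ≢⇒RGB triple (far≢ comps x≁y)
  ... | inj₁ rxy = case trans (sym rxy) (far wx wy x≁y) of λ ()
  ... | inj₂ gb  = gb

  G⇒¬B : ∀ {x y} → G x y ≡ true → B x y ≡ true → ⊥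
  G⇒¬B gxy bxy = case trans (sym bxy) (R⇒¬G (rotate triple) gxy) of λ ()

  -- Homogeneity moves one end of the edge at a time within its component.
  block : ∀ {u v a b} → W v ≡ true → W a ≡ true → W b ≡ true → label u ≡ label a → label v ≡ label b → u ≁ v →
          G u v ≡ true → G a b ≡ true
  block {u} {v} {a} {b} wv wa wb u~a v~b u≁v guv =
    trans (symG a b) (trans (sym (homG wa v~b λ e → u≁v (trans u~a (sym e))))
      (trans (symG v a) (trans (sym (homG wv u~a u≁v)) guv)))

  class-size : ∀ {x} → W x ≡ true → # (redN x) + 1 ≤ # (class x)
  class-size {x} wx = subst₂ _≤_ (cong (# (redN x) +_) (trans (+-identityʳ _) (#-single x))) (+-identityʳ _)
    (weigh (redN x ∷ (x ==_) ∷ []) (class x ∷ []) pointwise)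
    where
    go : ∀ {d r g b s} → One d r g b → (d ≡ true → s ≡ true) → (r ≡ true → s ≡ true) →
         ⟦ r ⟧ + (⟦ d ⟧ + 0) ≤ ⟦ s ⟧ + 0
    go {s = true}  diag  _ _ = by≤
    go {s = true}  red   _ _ = by≤
    go {s = true}  green _ _ = by≤
    go {s = true}  blue  _ _ = by≤
    go {s = false} diag  p _ = case p refl of λ ()
    go {s = false} red   _ p = case p refl of λ ()
    go {s = false} green _ _ = by≤
    go {s = false} blue  _ _ = by≤
    pointwise : ∀ z → ⟦ redN x z ⟧ + (⟦ x == z ⟧ + 0) ≤ ⟦ class x z ⟧ + 0
    pointwise z with W z in wz
    ... | false rewrite ≢⇒== {x = x} {z} (λ { refl → case trans (sym wx) wz of λ () }) = by≤
    ... | true = go (one x z) (λ e → subst (λ k → (label x == label k) ≡ true) (==⇒≡ e) (==-refl (label x)))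
                    (λ rxz → subst (λ k → (label x == k) ≡ true) (near wx wz rxz) (==-refl (label x)))

  -- The edge xy is not red, so `manyR` applies; `apart` puts those of its nine vertices that are
  -- outside W into Y.
  red-degrees : ∀ {x y} → W x ≡ true → W y ≡ true → x ≁ y → 9 ≤ # (redN x) + (# (redN y) + (# Y + 0))
  red-degrees {x} {y} wx wy x≁y =
    ≤-trans (≤-trans (manyR x y (far≢ comps x≁y) (far wx wy x≁y)) (≤-reflexive (sym (+-identityʳ _))))
      (weigh ((λ z → R x z or R y z) ∷ []) (redN x ∷ redN y ∷ Y ∷ []) pointwise)
    where
    pointwise : ∀ z → ⟦ R x z or R y z ⟧ + 0 ≤ ⟦ redN x z ⟧ + (⟦ redN y z ⟧ + (⟦ Y z ⟧ + 0))
    pointwise z with W z in wz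
    ... | true with R x z | R y z
    ...   | true  | _     = s≤s z≤n
    ...   | false | true  = s≤s z≤n
    ...   | false | false = z≤n
    pointwise z | false with Y z in yz
    ... | true with R x z or R y z
    ...   | true  = ≤-refl
    ...   | false = z≤n
    pointwise z | false | false rewrite apart wx wz yz | apart wy wz yz = ≤-refl

  module _ (n≡25 : n ≡ 25) where
    open Order25 n≡25

    classes-disjoint : ∀ xs → Unique (map label xs) → # Y + sum (map #_ (map class xs)) ≤ 25
    classes-disjoint xs uniq = ≤-trans (weigh (Y ∷ map class xs) (everything ∷ []) pointwise) (≤-reflexive total)
      where
      inW : ∀ xs z → W z ≡ true → sum (weights (map class xs) z) ≡ sum (map (λ k → ⟦ k == label z ⟧) (map label xs))
      inW []       z wz = refl
      inW (x ∷ xs) z wz rewrite inW xs z wz | wz = refl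
      outW : ∀ xs z → W z ≡ false → sum (weights (map class xs) z) ≡ 0
      outW []       z wz = refl
      outW (x ∷ xs) z wz rewrite outW xs z wz | wz = refl
      ⟦⟧≤1 : ∀ b → ⟦ b ⟧ ≤ 1
      ⟦⟧≤1 true  = by≤
      ⟦⟧≤1 false = by≤
      pointwise : ∀ z → ⟦ Y z ⟧ + sum (weights (map class xs) z) ≤ 1
      pointwise z with bool (Y z) | bool (W z)
      ... | inj₁ yz | _ rewrite yz | outW xs z (Y⇒¬W yz) = by≤
      ... | inj₂ yz | inj₁ wz rewrite yz | inW xs z wz = sum-unique uniq (label z)
      ... | inj₂ yz | inj₂ wz rewrite yz | outW xs z wz = by≤

    Y≤1 : # Y ≤ 1
    Y≤1 = +-cancelˡ-≤ 24 _ 1 (≤-trans (W≥24 ⊕ ≤-reflexive (sym (+-identityʳ (# Y))))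
      (≤-trans (weigh (W ∷ Y ∷ []) (everything ∷ []) λ z → go (W z) (Y z) Y⇒¬W) (≤-reflexive total)))
      where
      go : ∀ w y → (y ≡ true → w ≡ false) → ⟦ w ⟧ + (⟦ y ⟧ + 0) ≤ 1
      go true  true  p = case p refl of λ ()
      go true  false _ = by≤
      go false true  _ = by≤
      go false false _ = by≤

    -- Let s be the sum of the five red degrees in W and y the size of Y. Adding `red-degrees`
    -- around the cycle a, b, c, d, e gives 45 ≤ 2s + 5y. The classes have at least s + 5 and at
    -- most 25 - y vertices, so 45 ≤ 40 + 3y ≤ 43.
    no-fifth : ∀ {a b c d e} → Quad W label a b c d → W e ≡ true → a ≁ e → b ≁ e → c ≁ e → d ≁ e → ⊥
    no-fifth {a} {b} {c} {d} {e} q we ae be ce de = impossible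
      (red-degrees wa wb ab ⊕ red-degrees wb wc bc ⊕ red-degrees wc wd cd ⊕ red-degrees wd we de ⊕
       red-degrees we wa (ae ∘ sym) ⊕ sizes ⊕ sizes ⊕ disjoint ⊕ disjoint ⊕ Y≤1 ⊕ Y≤1 ⊕ Y≤1)
      1 (arith (# (redN a)) (# (redN b)) (# (redN c)) (# (redN d)) (# (redN e))
               (# (class a)) (# (class b)) (# (class c)) (# (class d)) (# (class e)) (# Y))
      where
      open Quad q
      sizes = class-size wa ⊕ class-size wb ⊕ class-size wc ⊕ class-size wd ⊕ class-size we
      disjoint : # Y + (# (class a) + (# (class b) + (# (class c) + (# (class d) + (# (class e) + 0))))) ≤ 25
      disjoint = classes-disjoint (a ∷ b ∷ c ∷ d ∷ e ∷ [])
        ((ab ∷ ac ∷ ad ∷ ae ∷ []) ∷ (bc ∷ bd ∷ be ∷ []) ∷ (cd ∷ ce ∷ []) ∷ (de ∷ []) ∷ [] ∷ [])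
      arith : ∀ na nb nc nd ne sa sb sc sd se y →
        9 + (9 + (9 + (9 + (9 +
          (((na + 1) + ((nb + 1) + ((nc + 1) + ((nd + 1) + (ne + 1))))) +
           (((na + 1) + ((nb + 1) + ((nc + 1) + ((nd + 1) + (ne + 1))))) +
            ((y + (sa + (sb + (sc + (sd + (se + 0)))))) + ((y + (sa + (sb + (sc + (sd + (se + 0)))))) +
             (y + (y + y)))))))))) ≡
        suc ((na + (nb + (y + 0))) + ((nb + (nc + (y + 0))) + ((nc + (nd + (y + 0))) + ((nd + (ne + (y + 0))) +
             ((ne + (na + (y + 0))) + ((sa + (sb + (sc + (sd + se)))) + ((sa + (sb + (sc + (sd + se)))) +
             (25 + (25 + (1 + (1 + 1)))))))))) + 1)
      arith = solve-∀

    cover : ∀ {a b c d} → Quad W label a b c d → ∀ {e} → W e ≡ true →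
            label a ≡ label e ⊎ label b ≡ label e ⊎ label c ≡ label e ⊎ label d ≡ label e
    cover {a} {b} {c} {d} q {e} we with label a ≟ label e | label b ≟ label e | label c ≟ label e | label d ≟ label e
    ... | yes ae | _      | _      | _      = inj₁ ae
    ... | no _   | yes be | _      | _      = inj₂ (inj₁ be)
    ... | no _   | no _   | yes ce | _      = inj₂ (inj₂ (inj₁ ce))
    ... | no _   | no _   | no _   | yes de = inj₂ (inj₂ (inj₂ de))
    ... | no ae  | no be  | no ce  | no de  = ⊥-elim (no-fifth q we ae be ce de)

    -- Otherwise b, c and d each have at least 9 - y red neighbours in W, where Y has y ≤ 1
    -- vertices, and the four classes together with Y have at least 1 + 3(10 - y) + y ≥ 29.
    red-neighbour : ∀ {a b c d} → Quad W label a b c d → ∃[ x ] W x ≡ true × R a x ≡ true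
    red-neighbour {a} {b} {c} {d} q = case pick {p = redN a} (≰⇒> λ na≤0 → impossible
      (red-degrees wa wb ab ⊕ red-degrees wa wc ac ⊕ red-degrees wa wd ad ⊕
       class-size wa ⊕ class-size wb ⊕ class-size wc ⊕ class-size wd ⊕
       classes-disjoint (a ∷ b ∷ c ∷ d ∷ []) ((ab ∷ ac ∷ ad ∷ []) ∷ (bc ∷ bd ∷ []) ∷ (cd ∷ []) ∷ [] ∷ []) ⊕
       Y≤1 ⊕ Y≤1 ⊕ na≤0 ⊕ na≤0)
      3 (arith (# (redN a)) (# (redN b)) (# (redN c)) (# (redN d))
               (# (class a)) (# (class b)) (# (class c)) (# (class d)) (# Y))) of λ
      (x , e) → x , ∧-true e
      where
      open Quad q
      arith : ∀ na nb nc nd sa sb sc sd y →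
        9 + (9 + (9 + ((na + 1) + ((nb + 1) + ((nc + 1) + ((nd + 1) + ((y + (sa + (sb + (sc + (sd + 0))))) +
          (y + (y + (na + na)))))))))) ≡
        suc ((na + (nb + (y + 0))) + ((na + (nc + (y + 0))) + ((na + (nd + (y + 0))) +
             (sa + (sb + (sc + (sd + (25 + (1 + (1 + (0 + 0)))))))))) + 3)
      arith = solve-∀

    -- At least nine vertices are seen in blue from x or x′. None of them lies in Y or in the
    -- classes of p and q, which x and x′ see in green. Outside the class of x the listed sets are
    -- disjoint; inside it a vertex is counted at most twice, whence the extra summand on the right.
    middle : ∀ {x x′ p q} → W x ≡ true → W x′ ≡ true → R x x′ ≡ true → W p ≡ true → W q ≡ true →
             p ≁ q → x ≁ p → x ≁ q → G x p ≡ true → G x q ≡ true →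
             # (class p) + (# (class q) + (1 + (1 + (9 + (# (redN x) + (# (redN x′) + (# Y + 0))))))) ≤
             25 + (# (class x) + 0)
    middle {x} {x′} {p} {q} wx wx′ rxx′ wp wq p≁q x≁p x≁q gxp gxq =
      ≤-trans (≤-refl {# (class p)} ⊕ ≤-refl {# (class q)} ⊕ #-single≥1 x ⊕ #-single≥1 x′ ⊕
               manyB x x′ (edge≢ triple rxx′) (R⇒¬G (swap triple) rxx′) ⊕ ≤-refl)
        (≤-trans (weigh (class p ∷ class q ∷ (x ==_) ∷ (x′ ==_) ∷ (λ z → B x z or B x′ z) ∷ redN x ∷ redN x′ ∷ Y ∷ [])
                        (everything ∷ class x ∷ []) pointwise)
                 (≤-reflexive (trans (#-everything n) n≡25) ⊕ ≤-refl))
      where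
      x~x′ = near wx wx′ rxx′
      rx′x = trans (symR x′ x) rxx′
      unequal : ∀ {u z} → W u ≡ true → W z ≡ false → (u == z) ≡ false
      unequal wu wz = ≢⇒== λ { refl → case trans (sym wu) wz of λ () }
      ¬Y : ∀ {z} → W z ≡ true → Y z ≡ false
      ¬Y {z} wz with bool (Y z)
      ... | inj₁ yz = case trans (sym wz) (Y⇒¬W yz) of λ ()
      ... | inj₂ yz = yz
      elsewhere : ∀ {u v z} → u ≁ v → label u ≡ label z → (label v == label z) ≡ false
      elsewhere u≁v u~z = ≢⇒== λ e → u≁v (trans u~z (sym e))
      green-to : ∀ {v z} → W v ≡ true → W z ≡ true → x ≁ v → G x v ≡ true → label v ≡ label z →
                 G x z ≡ true × G x′ z ≡ true
      green-to wv wz x≁v gxv v~z =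
        block wv wx wz refl v~z x≁v gxv , block wv wx′ wz x~x′ v~z x≁v gxv
      pointwise : ∀ z →
        ⟦ class p z ⟧ + (⟦ class q z ⟧ + (⟦ x == z ⟧ + (⟦ x′ == z ⟧ + (⟦ B x z or B x′ z ⟧ +
          (⟦ redN x z ⟧ + (⟦ redN x′ z ⟧ + (⟦ Y z ⟧ + 0))))))) ≤ 1 + (⟦ class x z ⟧ + 0)
      pointwise z with bool (W z)
      ... | inj₂ wz rewrite wz =
        pages-outside (one x z) (one x′ z) (unequal wx wz) (unequal wx′ wz) (joined wx) (joined wx′)
      ... | inj₁ wz with bool (label x == label z)
      ...   | inj₁ xz rewrite wz | ¬Y wz | xz | elsewhere x≁p (==⇒≡ xz) | elsewhere x≁q (==⇒≡ xz) =
        pages-same (one x z) (one x′ z) (at {C = R} rx′x) (at {C = R} rxx′)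
      ...   | inj₂ xz with bool (label p == label z) | bool (label q == label z)
      ...     | inj₁ pz | _ rewrite wz | ¬Y wz | xz | pz | elsewhere p≁q (==⇒≡ pz) =
        s≤s (let gx , gx′ = green-to wp wz x≁p gxp (==⇒≡ pz) in pages-green (one x z) (one x′ z) gx gx′)
      ...     | inj₂ pz | inj₁ qz rewrite wz | ¬Y wz | xz | pz | qz =
        s≤s (let gx , gx′ = green-to wq wz x≁q gxq (==⇒≡ qz) in pages-green (one x z) (one x′ z) gx gx′)
      ...     | inj₂ pz | inj₂ qz rewrite wz | ¬Y wz | xz | pz | qz =
        pages-far (one x z) (one x′ z) (far≢ comps x≁z) (far≢ comps x′≁z) (far wx wz x≁z) (far wx′ wz x′≁z)
        where
        x≁z = ==⇒≢ xz
        x′≁z = λ e → x≁z (trans x~x′ e)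

    -- Apply `middle` to red edges bb′ and cc′ in the inner components and add: the sizes of these
    -- components cancel. `red-degrees` for bc and for b′c′ bounds the remaining red degrees and Y
    -- from below, leaving at most 50 - 22 - 18 = 10 for the ends.
    path-ends : ∀ {a b c d} → Quad W label a b c d → G a b ≡ true → G b c ≡ true → G c d ≡ true →
                # (class a) + # (class d) ≤ 10
    path-ends {a} {b} {c} {d} q gab gbc gcd =
      case red-neighbour (turn-quad q) , red-neighbour (turn-quad (turn-quad q)) of λ
        { ((b′ , wb′ , rbb′) , (c′ , wc′ , rcc′)) → ≮⇒≥ λ 11≤ → impossible
          (middle wb wb′ rbb′ wa wc ac (ab ∘ sym) bc (trans (symG b a) gab) gbc ⊕
           middle wc wc′ rcc′ wb wd bd (bc ∘ sym) cd (trans (symG c b) gbc) gcd ⊕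
           red-degrees wb wc bc ⊕
           red-degrees wb′ wc′ (λ e → bc (trans (near wb wb′ rbb′) (trans e (sym (near wc wc′ rcc′))))) ⊕
           11≤)
          0 (arith (# (class a)) (# (class b)) (# (class c)) (# (class d))
                   (# (redN b)) (# (redN b′)) (# (redN c)) (# (redN c′)) (# Y)) }
      where
      open Quad q
      arith : ∀ sa sb sc sd nb nb′ nc nc′ y →
        (sa + (sc + (1 + (1 + (9 + (nb + (nb′ + (y + 0)))))))) +
        ((sb + (sd + (1 + (1 + (9 + (nc + (nc′ + (y + 0)))))))) + (9 + (9 + 11))) ≡
        suc ((25 + (sb + 0)) + ((25 + (sc + 0)) +
             ((nb + (nc + (y + 0))) + ((nb′ + (nc′ + (y + 0))) + (sa + sd)))) + 0)
      arith = solve-∀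

    quad-size : ∀ {a b c d} → Quad W label a b c d →
                24 ≤ # (class a) + (# (class b) + (# (class c) + (# (class d) + 0)))
    quad-size {a} {b} {c} {d} q = ≤-trans (≤-trans W≥24 (≤-reflexive (sym (+-identityʳ _))))
      (weigh (W ∷ []) (class a ∷ class b ∷ class c ∷ class d ∷ []) pointwise)
      where
      pointwise : ∀ z → ⟦ W z ⟧ + 0 ≤ ⟦ class a z ⟧ + (⟦ class b z ⟧ + (⟦ class c z ⟧ + (⟦ class d z ⟧ + 0)))
      pointwise z with bool (W z)
      ... | inj₂ wz rewrite wz = z≤n
      ... | inj₁ wz with cover q wz
      ...   | inj₁ e rewrite wz | e | ==-refl (label z) = s≤s z≤n
      ...   | inj₂ (inj₁ e) rewrite wz | e | ==-refl (label z) = ≤-trans (s≤s z≤n) (m≤n+m _ ⟦ label a == label z ⟧)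
      ...   | inj₂ (inj₂ (inj₁ e)) rewrite wz | e | ==-refl (label z) =
        ≤-trans (≤-trans (s≤s z≤n) (m≤n+m _ ⟦ label b == label z ⟧)) (m≤n+m _ ⟦ label a == label z ⟧)
      ...   | inj₂ (inj₂ (inj₂ e)) rewrite wz | e | ==-refl (label z) =
        ≤-trans (≤-trans (≤-trans (s≤s z≤n) (m≤n+m _ ⟦ label c == label z ⟧)) (m≤n+m _ ⟦ label b == label z ⟧))
                (m≤n+m _ ⟦ label a == label z ⟧)

  -- Otherwise the component of u is joined in green to the rest of W, against `noG`.
  blue-neighbour : ∀ {u o} → W u ≡ true → W o ≡ true → u ≁ o → ∃[ x ] W x ≡ true × u ≁ x × B u x ≡ true
  blue-neighbour {u} {o} wu wo u≁o
    with any? (λ x → (W x ≟ᵇ true) ×-dec ¬? (label u ≟ label x) ×-dec (B u x ≟ᵇ true))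
  ... | yes found = found
  ... | no ∄ = ⊥-elim (noG (mkJoin (λ z → label u == label z) (u , wu , ==-refl (label u))
    (o , wo , ≢⇒== u≁o) λ {a} {b} wa wb ua ub →
      trans (sym (homG wb (==⇒≡ ua) (==⇒≢ ub))) (all-green wb (==⇒≢ ub))))
    where
    all-green : ∀ {b} → W b ≡ true → u ≁ b → G u b ≡ true
    all-green {b} wb u≁b with colour-far wu wb u≁b
    ... | inj₁ g = g
    ... | inj₂ e = contradiction (b , wb , u≁b , e) ∄

module _ {n} {R G B : Relation n} (n≡25 : n ≡ 25) (l : Layout R G B) where
  open Layout l
  open Split comps
  open Triple triple

  green-neighbour : ∀ {u o} → W u ≡ true → W o ≡ true → label u ≢ label o →
                    ∃[ x ] W x ≡ true × label u ≢ label x × G u x ≡ true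
  green-neighbour = blue-neighbour (swap-layout l)

  blue-block : ∀ {u v a b} → W v ≡ true → W a ≡ true → W b ≡ true → label u ≡ label a → label v ≡ label b →
               label u ≢ label v → B u v ≡ true → B a b ≡ true
  blue-block = block (swap-layout l)

  -- abcd is an induced green path and bdac an induced blue one; their inner
  -- components are the end components of the other.
  no-path : ∀ {a b c d} → Quad W label a b c d → G a b ≡ true → G b c ≡ true → G c d ≡ true →
            B b d ≡ true → B a d ≡ true → B a c ≡ true → ⊥
  no-path {a} {b} {c} {d} q gab gbc gcd bbd bad bac = impossible
    (quad-size l n≡25 q ⊕ path-ends l n≡25 q gab gbc gcd ⊕
     path-ends (swap-layout l) n≡25 (turn-last (turn-quad q)) bbd (trans (symB d a) bad) bac)
    3 (arith (# (class l a)) (# (class l b)) (# (class l c)) (# (class l d)))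
    where
    arith : ∀ sa sb sc sd → 24 + ((sa + sd) + (sb + sc)) ≡ suc ((sa + (sb + (sc + (sd + 0)))) + (10 + 10) + 3)
    arith = solve-∀

  -- A blue neighbour w of v lies in a fourth component, since v sees u and z in green. If wu and wz
  -- differ in colour, the green graph on the four components is a path. If both are blue, w has no
  -- green neighbour. If both are green, W is the green join of the components of v and w with those
  -- of u and z.
  no-triangle : ∀ {u v z} → W u ≡ true → W v ≡ true → W z ≡ true →
                label u ≢ label v → label u ≢ label z → label v ≢ label z →
                G u v ≡ true → B u z ≡ true → G v z ≡ true → ⊥
  no-triangle {u} {v} {z} wu wv wz u≁v u≁z v≁z guv buz gvz =
    case blue-neighbour l wv wu (u≁v ∘ sym) of λ
      { (w , ww , v≁w , bvw) →
          let u≁w = λ u~w → G⇒¬B l (trans (symG v u) guv) (blue-block ww wv wu refl (sym u~w) v≁w bvw)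
              z≁w = λ z~w → G⇒¬B l gvz (blue-block ww wv wz refl (sym z~w) v≁w bvw)
          in fourth ww u≁w v≁w z≁w bvw (colour-far l ww wu (u≁w ∘ sym)) (colour-far l ww wz (z≁w ∘ sym)) }
    where
    fourth : ∀ {w} → W w ≡ true → label u ≢ label w → label v ≢ label w → label z ≢ label w → B v w ≡ true →
             G w u ≡ true ⊎ B w u ≡ true → G w z ≡ true ⊎ B w z ≡ true → ⊥
    fourth {w} ww u≁w v≁w z≁w bvw = go
      where
      bwv = trans (symB w v) bvw
      q : Quad W label w u v z
      q = record { wa = ww ; wb = wu ; wc = wv ; wd = wz ; ab = u≁w ∘ sym ; ac = v≁w ∘ sym ; ad = z≁w ∘ sym
                 ; bc = u≁v ; bd = u≁z ; cd = v≁z }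
      go : G w u ≡ true ⊎ B w u ≡ true → G w z ≡ true ⊎ B w z ≡ true → ⊥
      go (inj₁ gwu) (inj₂ bwz) = no-path q gwu guv gvz buz bwz bwv
      go (inj₂ bwu) (inj₁ gwz) =
        no-path (turn-quad q) guv gvz (trans (symG z w) gwz) bvw (trans (symB u w) bwu) buz
      go (inj₂ bwu) (inj₂ bwz) = case green-neighbour ww wu (u≁w ∘ sym) of λ
        { (x , wx , w≁x , gwx) → case cover l n≡25 q wx of λ
          { (inj₁ w~x) → w≁x w~x
          ; (inj₂ (inj₁ u~x)) → G⇒¬B l gwx (blue-block wu ww wx refl u~x (u≁w ∘ sym) bwu)
          ; (inj₂ (inj₂ (inj₁ v~x))) → G⇒¬B l gwx (blue-block wv ww wx refl v~x (v≁w ∘ sym) bwv)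
          ; (inj₂ (inj₂ (inj₂ z~x))) → G⇒¬B l gwx (blue-block wz ww wx refl z~x (z≁w ∘ sym) bwz) } }
      go (inj₁ gwu) (inj₁ gwz) = noG (mkJoin side (v , wv , side-v refl) (u , wu , side-u) cross)
        where
        side : Fin n → Bool
        side x = (label v == label x) or (label w == label x)
        side-v : ∀ {x} → label v ≡ label x → side x ≡ true
        side-v {x} e rewrite e | ==-refl (label x) = refl
        side-w : ∀ {x} → label w ≡ label x → side x ≡ true
        side-w {x} e rewrite e | ==-refl (label x) with label v == label x
        ... | true  = refl
        ... | false = refl
        side-u : side u ≡ false
        side-u rewrite ≢⇒== (u≁v ∘ sym) | ≢⇒== (u≁w ∘ sym) = refl
        side⇒ : ∀ {x} → side x ≡ true → label v ≡ label x ⊎ label w ≡ label x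
        side⇒ {x} e with label v ≟ label x | label w ≟ label x
        ... | yes v~x | _       = inj₁ v~x
        ... | no _    | yes w~x = inj₂ w~x
        side⇐ : ∀ {x} → W x ≡ true → side x ≡ false → label u ≡ label x ⊎ label z ≡ label x
        side⇐ wx e with cover l n≡25 q wx
        ... | inj₁ w~x = case trans (sym (side-w w~x)) e of λ ()
        ... | inj₂ (inj₁ u~x) = inj₁ u~x
        ... | inj₂ (inj₂ (inj₁ v~x)) = case trans (sym (side-v v~x)) e of λ ()
        ... | inj₂ (inj₂ (inj₂ z~x)) = inj₂ z~x
        cross : ∀ {x y} → W x ≡ true → W y ≡ true → side x ≡ true → side y ≡ false → G x y ≡ true
        cross wx wy sx sy with side⇒ sx | side⇐ wy sy
        ... | inj₁ v~x | inj₁ u~y = block l wu wx wy v~x u~y (u≁v ∘ sym) (trans (symG v u) guv)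
        ... | inj₁ v~x | inj₂ z~y = block l wz wx wy v~x z~y v≁z gvz
        ... | inj₂ w~x | inj₁ u~y = block l wu wx wy w~x u~y (u≁w ∘ sym) gwu
        ... | inj₂ w~x | inj₂ z~y = block l wz wx wy w~x z~y (z≁w ∘ sym) gwz

-- A component has a green neighbour v and a blue neighbour z among the others; whichever colour vz
-- has, the three components form a triangle excluded by `no-triangle`, up to exchanging green and
-- blue.
no-layout : ∀ {n} {R G B : Relation n} → n ≡ 25 → (l : Layout R G B) → Cut (λ z → Layout.W l z ≡ true) R → ⊥
no-layout {R = R} {G} {B} n≡25 l cut =
  let u , o , wu , wo , u≁o = cutℓ cut
      v , wv , u≁v , guv = blue-neighbour (swap-layout l) wu wo u≁o
      z , wz , u≁z , buz = blue-neighbour l wu wo u≁o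
      v≁z = λ v~z → G⇒¬B l (block l wv wu wz refl v~z u≁v guv) buz
  in case colour-far l wv wz v≁z of λ
       { (inj₁ gvz) → no-triangle n≡25 l wu wv wz u≁v u≁z v≁z guv buz gvz
       ; (inj₂ bvz) → no-triangle n≡25 (swap-layout l) wu wz wv u≁z u≁v (v≁z ∘ sym) buz guv
                        (trans (symB z v) bvz) }
  where
  open Layout l
  open Split comps
  open Triple triple
-- The upper bound

everything-except : ∀ {n} → n ≡ 25 → (y : Fin n) → 24 ≤ # (except y)
everything-except {n} n≡25 y = +-cancelʳ-≤ 1 24 _ (subst₂ _≤_ total
  (cong (# (except y) +_) (trans (+-identityʳ _) (#-single y)))
  (weigh (everything ∷ []) (except y ∷ (y ==_) ∷ []) λ z → go (y == z)))
  where
  open Order25 n≡25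
  go : ∀ b → 1 ≤ ⟦ not b ⟧ + (⟦ b ⟧ + 0)
  go true  = by≤
  go false = by≤

any-cut : ∀ {n} {R G B : Relation n} → Triple R G B → (W : Fin n → Bool) → 2 ≤ # W →
          AnyCut R G B (λ z → W z ≡ true)
any-cut {n} {R} {G} {B} t W 2≤W =
  let x , y , wx , wy , x≢y = two-members 2≤W
  in case disconnected t members (∈-filter⁺ W? (∈-allFin x) wx) (∈-filter⁺ W? (∈-allFin y) wy) x≢y of λ
    { (inj₁ c) → inj₁ (convert c) ; (inj₂ (inj₁ c)) → inj₂ (inj₁ (convert c))
    ; (inj₂ (inj₂ c)) → inj₂ (inj₂ (convert c)) }
  where
  W? = λ z → W z ≟ᵇ true
  members = filter W? (allFin n)
  inW : ∀ {z} → z ∈ˡ members → W z ≡ true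
  inW z∈ = proj₂ (∈-filter⁻ W? {xs = allFin n} z∈)
  convert : ∀ {C} → Cut (_∈ˡ members) C → Cut (λ z → W z ≡ true) C
  convert (mkCut S (a , a∈ , sa) (b , b∈ , sb) across) =
    mkCut S (a , inW a∈ , sa) (b , inW b∈ , sb) λ wu wv →
      across (∈-filter⁺ W? (∈-allFin _) wu) (∈-filter⁺ W? (∈-allFin _) wv)

nothing-else : ∀ {n} → Fin n → Bool
nothing-else _ = false

-- Without y no colour is a join, while some colour is disconnected there. If it is red, y is the
-- vertex that all of W sees in red, so Y consists of y; if it is green or blue, y has no edge of
-- that colour and Y is empty.
no-universal : ∀ {n} {R G B : Relation n} → n ≡ 25 → Triple R G B → ∀ {y} → Universal R y → ⊥
no-universal {n} {R} {G} {B} n≡25 t {y} uy =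
  case any-cut t W (≤-trans by≤ W≥24) of λ
    { (inj₁ c) → no-layout n≡25 (record
        { W = W ; Y = y ==_ ; comps = split t W? ; Y⇒¬W = cong not
        ; joined = λ {x} wx y=z → subst (λ z → R x z ≡ true) (==⇒≡ y=z) (red-y wx)
        ; apart = λ wx ¬wz y≢z → case trans (sym (not-false ¬wz)) y≢z of λ ()
        ; W≥24 = W≥24 ; noG = noG ; noB = noB }) c
    ; (inj₂ (inj₁ c)) → no-layout n≡25 (record
        { W = W ; Y = nothing-else ; comps = split (rotate t) W? ; Y⇒¬W = λ () ; joined = λ _ ()
        ; apart = λ {x} wx ¬wz _ → subst (λ z → G x z ≡ false) (==⇒≡ (not-false ¬wz)) (R⇒¬G t (red-y wx))
        ; W≥24 = W≥24 ; noG = noB ; noB = noR }) c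
    ; (inj₂ (inj₂ c)) → no-layout n≡25 (record
        { W = W ; Y = nothing-else ; comps = split (rotate (rotate t)) W? ; Y⇒¬W = λ () ; joined = λ _ ()
        ; apart = λ {x} wx ¬wz _ → subst (λ z → B x z ≡ false) (==⇒≡ (not-false ¬wz)) (R⇒¬G (swap t) (red-y wx))
        ; W≥24 = W≥24 ; noG = noR ; noB = noG }) c
    }
  where
  W = except y
  W? = λ z → W z ≟ᵇ true
  W≥24 = everything-except n≡25 y
  red-y : ∀ {x} → W x ≡ true → R x y ≡ true
  red-y {x} wx = trans (Triple.symR t x y) (uy x (not-true wx))
  noR = no-red-join n≡25 t uy
  noG = no-green-join n≡25 t uy
  noB = no-green-join n≡25 (swap t) uy

no-cut-without-universal :
  ∀ {n} {R G B : Relation n} → n ≡ 25 → Triple R G B → (∀ y → ¬ Universal G y) → (∀ y → ¬ Universal B y) →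
  Cut (λ z → everything z ≡ true) R → ⊥
no-cut-without-universal {n} n≡25 t ¬uG ¬uB = no-layout n≡25 (record
  { W = everything ; Y = nothing-else ; comps = split t λ z → everything z ≟ᵇ true ; Y⇒¬W = λ () ; joined = λ _ ()
  ; apart = λ _ ()
  ; W≥24 = ≤-trans by≤ (≤-reflexive (sym (trans (#-everything n) n≡25)))
  ; noG = λ j → let y , uy = join⇒universal n≡25 (rotate t) j in ¬uG y uy
  ; noB = λ j → let y , uy = join⇒universal n≡25 (rotate (rotate t)) j in ¬uB y uy })

no-triple : ∀ {n} {R G B : Relation n} → n ≡ 25 → ¬ Triple R G B
no-triple {n} {R} {G} {B} n≡25 t =
  case any-cut t everything (≤-trans by≤ (≤-reflexive (sym (trans (#-everything n) n≡25)))) of λ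
    { (inj₁ c)        → no-cut-without-universal n≡25 t ¬uG ¬uB c
    ; (inj₂ (inj₁ c)) → no-cut-without-universal n≡25 (rotate t) ¬uB ¬uR c
    ; (inj₂ (inj₂ c)) → no-cut-without-universal n≡25 (rotate (rotate t)) ¬uR ¬uG c }
  where
  ¬uR = λ y → no-universal n≡25 t {y}
  ¬uG = λ y → no-universal n≡25 (rotate t) {y}
  ¬uB = λ y → no-universal n≡25 (rotate (rotate t)) {y}

-- From colourings to colour classes and from spines to books

module _ {n} (f : Coloring 3 (K n)) where
  open Coloring f using (undirected)

  colour-irrelevant : ∀ {x y} (e e′ : x ≢ y) → colour f e ≡ colour f e′
  colour-irrelevant e e′ = trans (undirected e (e ∘ sym)) (sym (undirected e′ (e ∘ sym)))

  hasColour : Fin 3 → Relation n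
  hasColour c x y with x ≟ y
  ... | yes _  = false
  ... | no x≢y = c == colour f x≢y

  has⇒ : ∀ {c x y} → hasColour c x y ≡ true → Σ[ e ∈ x ≢ y ] c ≡ colour f e
  has⇒ {c} {x} {y} h with x ≟ y
  ... | no x≢y = x≢y , ==⇒≡ h

  lacks⇒ : ∀ {c x y} → hasColour c x y ≡ false → (e : x ≢ y) → colour f e ≢ c
  lacks⇒ {c} {x} {y} h e with x ≟ y
  ... | yes x≡y = contradiction x≡y e
  ... | no x≢y  = λ eq → ==⇒≢ h (trans (sym eq) (colour-irrelevant e x≢y))

  has-sym : ∀ c x y → hasColour c x y ≡ hasColour c y x
  has-sym c x y with x ≟ y | y ≟ x
  ... | yes _   | yes _   = refl
  ... | yes x≡y | no y≢x  = contradiction (sym x≡y) y≢x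
  ... | no x≢y  | yes y≡x = contradiction (sym y≡x) x≢y
  ... | no x≢y  | no y≢x  = cong (c ==_) (undirected x≢y y≢x)

  one-colour : ∀ x y → One (x == y) (hasColour zero x y) (hasColour (suc zero) x y) (hasColour (suc (suc zero)) x y)
  one-colour x y with x ≟ y
  ... | yes _  = diag
  ... | no x≢y with colour f x≢y
  ...   | zero           = red
  ...   | suc zero       = green
  ...   | suc (suc zero) = blue

  no-rainbow : Gallai f → ∀ x y z → hasColour zero x y ≡ true → hasColour (suc zero) x z ≡ true →
               hasColour (suc (suc zero)) y z ≡ true → ⊥
  no-rainbow gallai x y z hxy hxz hyz with has⇒ hxy | has⇒ hxz | has⇒ hyz
  ... | xy , cxy | xz , cxz | yz , cyz = gallai (x , y , z , xy , xz , yz ,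
    (λ e → case trans cxy (trans e (sym cxz)) of λ ()) ,
    (λ e → case trans cxy (trans e (sym cyz)) of λ ()) ,
    (λ e → case trans cxz (trans e (sym cyz)) of λ ()))

  page : Fin 3 → Fin n → Fin n → Fin n → Bool
  page c x y z = not (hasColour c x z or hasColour c y z) ∧ (not (x == z) ∧ not (y == z))

  Spine : Set
  Spine = ∃[ c ] ∃[ x ] ∃[ y ] (x == y) ≡ false × hasColour c x y ≡ false × 15 ≤ # (page c x y)

  -- Deciding this by search is what turns the refutation of `Triple` into an actual copy of the
  -- book.
  spine? : Dec Spine
  spine? = any? λ c → any? λ x → any? λ y →
    ((x == y) ≟ᵇ false) ×-dec (hasColour c x y ≟ᵇ false) ×-dec (15 ≤? # (page c x y))

  page⇒ : ∀ {p q d d′} → not (p or q) ∧ (not d ∧ not d′) ≡ true →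
          p ≡ false × q ≡ false × d ≡ false × d′ ≡ false
  page⇒ {false} {false} {false} {false} _ = refl , refl , refl , refl

  spine⇒book : Spine → Σ[ copy ∈ Copy (Book 15) (K n) ] UsesAtMost 2 f copy
  spine⇒book (c , x , y , x≢y , ¬cxy , le) with φ , inj , φ-page ← embed 15 (page c x y) le =
    record { vertex = vertex ; injective = injective _ _ ; edge = λ {u} {v} → edge {u} {v} } ,
    ∁ ⁅ c ⁆ , ≤-reflexive (trans (∣∁p∣≡n∸∣p∣ ⁅ c ⁆) (cong (3 ∸_) (∣⁅x⁆∣≡1 c))) ,
    λ {u} {v} e → x∉p⇒x∈∁p (avoids u v e (edge {u} {v} e) ∘ x∈⁅y⁆⇒x≡y _)
    where
    vertex : Vertex (Book 15) → Fin n
    vertex (inj₁ zero)       = x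
    vertex (inj₁ (suc zero)) = y
    vertex (inj₂ i)          = φ i
    lacks : ∀ i → hasColour c x (φ i) ≡ false × hasColour c y (φ i) ≡ false ×
                  (x == φ i) ≡ false × (y == φ i) ≡ false
    lacks i = page⇒ (φ-page i)
    x≢φ : ∀ i → x ≢ φ i
    x≢φ i = ==⇒≢ (proj₁ (proj₂ (proj₂ (lacks i))))
    y≢φ : ∀ i → y ≢ φ i
    y≢φ i = ==⇒≢ (proj₂ (proj₂ (proj₂ (lacks i))))
    injective : ∀ u v → vertex u ≡ vertex v → u ≡ v
    injective (inj₁ zero)       (inj₁ zero)       _ = refl
    injective (inj₁ zero)       (inj₁ (suc zero)) e = contradiction e (==⇒≢ x≢y)
    injective (inj₁ (suc zero)) (inj₁ zero)       e = contradiction (sym e) (==⇒≢ x≢y)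
    injective (inj₁ (suc zero)) (inj₁ (suc zero)) _ = refl
    injective (inj₁ zero)       (inj₂ i)          e = contradiction e (x≢φ i)
    injective (inj₁ (suc zero)) (inj₂ i)          e = contradiction e (y≢φ i)
    injective (inj₂ i)          (inj₁ zero)       e = contradiction (sym e) (x≢φ i)
    injective (inj₂ i)          (inj₁ (suc zero)) e = contradiction (sym e) (y≢φ i)
    injective (inj₂ i)          (inj₂ j)          e = cong inj₂ (inj e)
    edge : ∀ {u v} → Adj (Book 15) u v → vertex u ≢ vertex v
    edge {u} {v} e eq = Graph.irrefl (Book 15) {u} {v} (injective u v eq) e
    avoids : ∀ u v → Adj (Book 15) u v → (e : vertex u ≢ vertex v) → colour f e ≢ c
    avoids (inj₁ zero)       (inj₁ zero)       a = contradiction refl a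
    avoids (inj₁ zero)       (inj₁ (suc zero)) _ = lacks⇒ ¬cxy
    avoids (inj₁ (suc zero)) (inj₁ zero)       _ = lacks⇒ (trans (has-sym c y x) ¬cxy)
    avoids (inj₁ (suc zero)) (inj₁ (suc zero)) a = contradiction refl a
    avoids (inj₁ zero)       (inj₂ i)          _ = lacks⇒ (proj₁ (lacks i))
    avoids (inj₁ (suc zero)) (inj₂ i)          _ = lacks⇒ (proj₁ (proj₂ (lacks i)))
    avoids (inj₂ i)          (inj₁ zero)       _ = lacks⇒ (trans (has-sym c (φ i) x) (proj₁ (lacks i)))
    avoids (inj₂ i)          (inj₁ (suc zero)) _ = lacks⇒ (trans (has-sym c (φ i) y) (proj₁ (proj₂ (lacks i))))

  spineless⇒triple : n ≡ 25 → Gallai f → ¬ Spine →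
                     Triple (hasColour zero) (hasColour (suc zero)) (hasColour (suc (suc zero)))
  spineless⇒triple n≡25 gallai spineless = record
    { one = one-colour ; symR = has-sym _ ; symG = has-sym _ ; symB = has-sym _ ; gallai = no-rainbow gallai
    ; manyR = many zero ; manyG = many (suc zero) ; manyB = many (suc (suc zero)) }
    where
    open Order25 n≡25
    go : ∀ p d d′ → 1 ≤ ⟦ p ⟧ + (⟦ not p ∧ (not d ∧ not d′) ⟧ + (⟦ d ⟧ + (⟦ d′ ⟧ + 0)))
    go true  _     _     = s≤s z≤n
    go false true  _     = s≤s z≤n
    go false false true  = by≤
    go false false false = by≤
    many : ∀ c x y → (x == y) ≡ false → hasColour c x y ≡ false → 9 ≤ # (λ z → hasColour c x z or hasColour c y z)
    -- At most 8 vertices seen in c, at most 14 pages and the two ends make only 24.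
    many c x y x≢y ¬cxy = ≮⇒≥ λ few → spineless (c , x , y , x≢y , ¬cxy , ≮⇒≥ λ { (s≤s short) →
      impossible
        (≤-trans (≤-trans (≤-reflexive (sym total))
                   (weigh (everything ∷ [])
                          ((λ z → hasColour c x z or hasColour c y z) ∷ page c x y ∷ (x ==_) ∷ (y ==_) ∷ [])
                          (λ z → go (hasColour c x z or hasColour c y z) (x == z) (y == z))))
                 (≤-pred few ⊕ short ⊕ ≤-reflexive (#-single x) ⊕ ≤-reflexive (#-single y) ⊕ ≤-refl))
        0 refl })

upper-bound : ∀ {n} → n ≡ 25 → EveryGallaiColoringContains 3 2 (Book 15) n
upper-bound n≡25 f gallai = case spine? f of λ
  { (yes spine)    → spine⇒book f spine
  ; (no spineless) → ⊥-elim (no-triple n≡25 (spineless⇒triple f n≡25 gallai spineless)) }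

-- The lower bound

-- The nonzero squares modulo 13. As -1 is among them, the absolute difference decides adjacency in
-- the Paley graph.
square₁₃ : ℕ → Bool
square₁₃ 1  = true
square₁₃ 3  = true
square₁₃ 4  = true
square₁₃ 9  = true
square₁₃ 10 = true
square₁₃ 12 = true
square₁₃ _  = false

-- The first two arguments tell in which copy the ends lie; the third, whether their difference is a
-- square.
tint : Bool → Bool → Bool → Fin 3
tint true  true  true  = zero
tint true  true  false = suc zero
tint false false true  = zero
tint false false false = suc zero
tint _     _     _     = suc (suc zero)

-- Two copies of the Paley graph of order 13 less a vertex, joined in the third
-- colour.
paley : ℕ → ℕ → Fin 3
-- Only differences matter within a copy, so the second copy, on 12 to 23, needs no shift.
paley i j = tint (i <ᵇ 12) (j <ᵇ 12) (square₁₃ ∣ i - j ∣)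

paley-sym : ∀ i j → paley i j ≡ paley j i
paley-sym i j rewrite ∣-∣-comm i j = go (i <ᵇ 12) (j <ᵇ 12) (square₁₃ ∣ j - i ∣)
  where
  go : ∀ h k s → tint h k s ≡ tint k h s
  go true  true  _     = refl
  go true  false true  = refl
  go true  false false = refl
  go false true  true  = refl
  go false true  false = refl
  go false false _     = refl

two-tints : ∀ h p q r → tint h h p ≢ tint h h q → tint h h p ≢ tint h h r → tint h h q ≢ tint h h r → ⊥
two-tints h true  true  _     d _ _ = d refl
two-tints h false false _     d _ _ = d refl
two-tints h true  false true  _ d _ = d refl
two-tints h true  false false _ _ d = d refl
two-tints h false true  true  _ _ d = d refl
two-tints h false true  false _ d _ = d refl

tint-across : ∀ h p → tint h (not h) p ≡ suc (suc zero) × tint (not h) h p ≡ suc (suc zero)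
tint-across true  true  = refl , refl
tint-across true  false = refl , refl
tint-across false true  = refl , refl
tint-across false false = refl , refl

-- A triangle inside one copy has only two colours; otherwise one vertex is separated from the other
-- two and sees both in the third colour.
tint-gallai : ∀ h k l p q r → tint h k p ≢ tint h l q → tint h k p ≢ tint k l r → tint h l q ≢ tint k l r → ⊥
tint-gallai true  true  true  p q r d d′ d″ = two-tints true p q r d d′ d″
tint-gallai false false false p q r d d′ d″ = two-tints false p q r d d′ d″
tint-gallai true  true  false p q r _ _ d = d (trans (proj₁ (tint-across true q)) (sym (proj₁ (tint-across true r))))
tint-gallai false false true  p q r _ _ d = d (trans (proj₁ (tint-across false q)) (sym (proj₁ (tint-across false r))))
tint-gallai true  false true  p q r _ d _ = d (trans (proj₁ (tint-across true p)) (sym (proj₁ (tint-across false r))))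
tint-gallai false true  false p q r _ d _ = d (trans (proj₁ (tint-across false p)) (sym (proj₁ (tint-across true r))))
tint-gallai true  false false p q r d _ _ = d (trans (proj₁ (tint-across true p)) (sym (proj₁ (tint-across true q))))
tint-gallai false true  true  p q r d _ _ = d (trans (proj₁ (tint-across false p)) (sym (proj₁ (tint-across false q))))

avoiding : Fin 3 → Relation 24
avoiding c x y = not (x == y) ∧ not (paley (toℕ x) (toℕ y) == c)

every : ∀ {n} → (Fin n → Bool) → Bool
every {zero}  p = true
every {suc n} p = p zero ∧ every (p ∘ suc)

every-sound : ∀ {n} (p : Fin n → Bool) → every p ≡ true → ∀ i → p i ≡ true
every-sound p e zero    = proj₁ (∧-true e)
every-sound p e (suc i) = every-sound (p ∘ suc) (proj₂ (∧-true {p zero} e)) i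

common : Fin 3 → Fin 24 → Fin 24 → Fin 24 → Bool
common c x y z = avoiding c x z ∧ avoiding c y z

few-pages : Fin 3 → Fin 24 → Fin 24 → Bool
few-pages c x y = not (avoiding c x y) or (# (common c x y) ≤ᵇ 14)

-- Checked by evaluation. The value 14 is reached on an edge inside a copy when its own colour and
-- the third are allowed: 12 pages in the other copy and up to two in the same one, as adjacent
-- vertices of the Paley graph of order 13, or of its complement, have two common neighbours.
always-few-pages : every (λ c → every λ x → every (few-pages c x)) ≡ true
always-few-pages = refl

paley-pages : ∀ c x y → avoiding c x y ≡ true → # (common c x y) ≤ 14
paley-pages c x y = go
  (every-sound (few-pages c x)
    (every-sound (λ x → every (few-pages c x))
      (every-sound (λ c → every λ x → every (few-pages c x)) always-few-pages c) x) y)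
  where
  go : ∀ {a m} → not a or (m ≤ᵇ 14) ≡ true → a ≡ true → m ≤ 14
  go {true} {m} e _ = ≤ᵇ⇒≤ m 14 (subst T (sym e) tt)

missing-colour : (S : Subset 3) → ∣ S ∣ ≤ 2 → ∃[ c ] (∀ {d} → d ∈ S → d ≢ c)
missing-colour (outside ∷ _ ∷ _ ∷ []) _ = zero , λ { () refl }
missing-colour (inside ∷ outside ∷ _ ∷ []) _ = suc zero , λ { (there ()) refl }
missing-colour (inside ∷ inside ∷ outside ∷ []) _ = suc (suc zero) , λ { (there (there ())) refl }
missing-colour (inside ∷ inside ∷ inside ∷ []) (s≤s (s≤s ()))

paley-coloring : ∀ q → Coloring 3 (K q)
paley-coloring q = record
  { colour     = λ {u} {v} _ → paley (toℕ u) (toℕ v)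
  ; undirected = λ {u} {v} _ _ → paley-sym (toℕ u) (toℕ v)
  }

paley-gallai : ∀ q → Gallai (paley-coloring q)
paley-gallai q (x , y , z , _ , _ , _ , d , d′ , d″) =
  tint-gallai (toℕ x <ᵇ 12) (toℕ y <ᵇ 12) (toℕ z <ᵇ 12) _ _ _ d d′ d″

module _ {q} (q≤24 : q ≤ 24) (copy : Copy (Book 15) (K q)) (c : Fin 3)
         (c-free : ∀ {u v} (e : Adj (Book 15) u v) → colour (paley-coloring q) (Copy.edge copy {u} {v} e) ≢ c) where
  open Copy copy

  -- The colouring of a smaller complete graph is a restriction of that of order 24, so the single
  -- evaluation above serves every q.
  place : Vertex (Book 15) → Fin 24
  place u = inject≤ (vertex u) q≤24

  place-injective : ∀ {u v} → place u ≡ place v → u ≡ v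
  place-injective e = injective (inject≤-injective q≤24 q≤24 _ _ e)

  avoids : ∀ u v → Adj (Book 15) u v → avoiding c (place u) (place v) ≡ true
  avoids u v e
    rewrite ≢⇒== {x = place u} {place v} (λ eq → Graph.irrefl (Book 15) {u} {v} (place-injective eq) e)
          | toℕ-inject≤ (vertex u) q≤24 | toℕ-inject≤ (vertex v) q≤24
          | ≢⇒== (c-free {u} {v} e) = refl

  no-copy : ⊥
  no-copy = impossible
    (≤-trans (injection⇒# {p = common c x y} {φ = place ∘ inj₂} (inj₂-injective ∘ place-injective) pages)
             (paley-pages c x y (avoids (inj₁ zero) (inj₁ (suc zero)) λ ())))
    0 refl
    where
    x y : Fin 24
    x = place (inj₁ zero)
    y = place (inj₁ (suc zero))
    pages : ∀ i → common c x y (place (inj₂ i)) ≡ true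
    pages i = cong₂ _∧_ (avoids (inj₁ zero) (inj₂ i) tt) (avoids (inj₁ (suc zero)) (inj₂ i) tt)

lower-bound : ∀ q → EveryGallaiColoringContains 3 2 (Book 15) q → 25 ≤ q
lower-bound q contains = ≮⇒≥ λ { (s≤s q≤24) →
  case contains (paley-coloring q) (paley-gallai q) of λ { (copy , S , ∣S∣≤2 , inS) →
  case missing-colour S ∣S∣≤2 of λ { (c , c∉S) →
  no-copy q≤24 copy c λ {u} {v} e → c∉S (inS {u} {v} e) } } }

theorem4p11 : gr[ 3 , 2 ] (Book 15) ≔ 25
theorem4p11 = upper-bound refl , lower-bound
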